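{- Let $G$ be a claw-free graph that is not quasi-line, with $\alpha(G)=3$. If $G$ is facet-defining, then $G$ is ${\rm LS}_+$-imperfect.
   Context: All graphs are finite and simple; $\alpha(G)$ is the stability number. A graph is claw-free if it has no induced $K_{1,3}$; it is quasi-line if the neighborhood of every node can be partitioned into two cliques. ${\rm STAB}(G)$ is the convex hull of incidence vectors of stable sets of $G=(V,E)$; $G$ is facet-defining if ${\rm STAB}(G)$ has a facet with all left-hand-side coefficients nonzero. ${\rm ESTAB}(G)=\{x\in[0,1]^V: x_i+x_j\le1,\ ij\in E\}$. For convex $K\subseteq[0,1]^n$: $\mathrm{cone}(K)=\{(x_0,x): x=x_0y, y\in K\}$; $M_+(K)$ is the set of symmetric positive semidefinite $(n+1)\times(n+1)$ matrices $Y$ (indices $0,\dots,n$) with $Ye_0=\mathrm{diag}(Y)$, $Ye_i\in\mathrm{cone}(K)$, $Y(e_0-e_i)\in\mathrm{cone}(K)$ for $i=1,\dots,n$; ${\rm LS}_+(K)=\{x\in[0,1]^n:(1,x)^T=Ye_0 \text{ for some } Y\in M_+(K)\}$. $G$ is ${\rm LS}_+$-perfect if ${\rm LS}_+({\rm ESTAB}(G))={\rm STAB}(G)$, and ${\rm LS}_+$-imperfect otherwise. -}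

module Defs where

open import Algebra.Bundles using (CommutativeRing)
open import Data.Bool.Base using (if_then_else_)
open import Data.Fin.Base using (Fin; zero; suc)
open import Data.Fin.Properties using (_≟_)
open import Data.Fin.Subset using (Subset; _∈_; _∪_; _∩_; Empty; ∣_∣)
open import Data.Nat.Base as ℕ using (ℕ)
open import Data.Product.Base using (Σ; ∃; ∃-syntax; _×_; _,_)
open import Data.Sum.Base using (_⊎_; inj₁; inj₂)
open import Data.Vec.Base using (lookup; tabulate)
open import Data.Vec.Functional using (Vector; _∷_)
open import Function.Definitions using (Injective)
open import Level using (0ℓ) renaming (suc to lsuc)
open import Relation.Binary.Core using (Rel)
open import Relation.Binary.Definitions using (Decidable; Irreflexive; Symmetric)
open import Relation.Binary.PropositionalEquality.Core using (_≡_; _≢_; refl)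
open import Relation.Binary.Structures using (IsDecTotalOrder)
open import Relation.Nullary using (¬_; does)
open import Relation.Nullary.Decidable using (_×-dec_; _⊎-dec_; ¬?)
open import Relation.Unary using (Pred; _⊆_; _≐_)

import Algebra.Properties.CommutativeMonoid.Sum as Sum

-- ℝ is characterised by the axioms of a complete ordered field, which
-- determine it up to isomorphism in classical mathematics; deciding the order
-- is part of that classical reading.
record CompleteOrderedField : Set (lsuc 0ℓ) where
  field
    commutativeRing : CommutativeRing 0ℓ 0ℓ

  open CommutativeRing commutativeRing public
    using (Carrier; _≈_; _+_; _*_; -_; _-_; 0#; 1#; +-commutativeMonoid)

  infix 4 _≤_

  field
    _≤_             : Rel Carrier 0ℓ
    isDecTotalOrder : IsDecTotalOrder _≈_ _≤_
    0≉1             : ¬ 0# ≈ 1#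
    inverse         : ∀ x → ¬ x ≈ 0# → ∃[ y ] x * y ≈ 1#
    +-monoˡ-≤       : ∀ z {x y} → x ≤ y → x + z ≤ y + z
    *-nonNegative   : ∀ {x y} → 0# ≤ x → 0# ≤ y → 0# ≤ x * y

  UpperBound : Pred Carrier 0ℓ → Pred Carrier 0ℓ
  UpperBound P u = ∀ x → P x → x ≤ u

  field
    supremum : (P : Pred Carrier 0ℓ) → ∃ P → ∃ (UpperBound P) →
               ∃[ s ] UpperBound P s × (∀ u → UpperBound P u → s ≤ u)

------------------------------------------------------------------------
-- Graphs

record Graph (n : ℕ) : Set (lsuc 0ℓ) where
  infix 4 _∼_ _∼?_
  field
    _∼_      : Rel (Fin n) 0ℓ
    ∼-sym    : Symmetric _∼_
    ∼-irrefl : Irreflexive _≡_ _∼_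
    _∼?_     : Decidable _∼_

record _InducedIn_ {m n} (H : Graph m) (G : Graph n) : Set where
  private
    module H = Graph H
    module G = Graph G
  field
    f         : Fin m → Fin n
    injective : Injective _≡_ _≡_ f
    preserves : ∀ {i j} → i H.∼ j → f i G.∼ f j
    reflects  : ∀ {i j} → f i G.∼ f j → i H.∼ j

-- The centre is the vertex zero.
K₁,₃ : Graph 4
K₁,₃ = record
  { _∼_      = λ i j → (i ≡ zero × j ≢ zero) ⊎ (i ≢ zero × j ≡ zero)
  ; ∼-sym    = λ { (inj₁ (p , q)) → inj₂ (q , p) ; (inj₂ (p , q)) → inj₁ (q , p) }
  ; ∼-irrefl = λ { refl (inj₁ (p , q)) → q p ; refl (inj₂ (p , q)) → p q }
  ; _∼?_     = λ i j → ((i ≟ zero) ×-dec ¬? (j ≟ zero))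
                       ⊎-dec (¬? (i ≟ zero) ×-dec (j ≟ zero))
  }

module _ {n} (G : Graph n) where
  open Graph G

  ClawFree : Set
  ClawFree = ¬ (K₁,₃ InducedIn G)

  neighbourhood : Fin n → Subset n
  neighbourhood v = tabulate λ u → does (v ∼? u)

  Clique : Subset n → Set
  Clique S = ∀ i j → i ∈ S → j ∈ S → i ≢ j → i ∼ j

  Stable : Subset n → Set
  Stable S = ∀ i j → i ∈ S → j ∈ S → ¬ i ∼ j

  -- The parts Q₁ and Q₂ may be empty.
  QuasiLine : Set
  QuasiLine = ∀ v → ∃[ Q₁ ] ∃[ Q₂ ]
    Clique Q₁ × Clique Q₂ × Q₁ ∪ Q₂ ≡ neighbourhood v × Empty (Q₁ ∩ Q₂)

  StabilityNumber : ℕ → Set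
  StabilityNumber k =
    (∃[ S ] Stable S × ∣ S ∣ ≡ k) × (∀ S → Stable S → ∣ S ∣ ℕ.≤ k)

module _ (ℝ : CompleteOrderedField) where
  open CompleteOrderedField ℝ
  open Sum +-commutativeMonoid using (sum)

  ----------------------------------------------------------------------
  -- Polyhedra

  infixl 7 _·_

  _·_ : ∀ {n} → Vector Carrier n → Vector Carrier n → Carrier
  x · y = sum λ i → x i * y i

  ConvexHull : ∀ {n} → Pred (Vector Carrier n) 0ℓ → Pred (Vector Carrier n) 0ℓ
  ConvexHull {n} X x =
    ∃[ m ] Σ (Vector Carrier m) λ c → Σ (Vector (Vector Carrier n) m) λ p →
      (∀ k → 0# ≤ c k) × sum c ≈ 1# × (∀ k → X (p k)) ×
      (∀ i → x i ≈ sum λ k → c k * p k i)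

  UnitCube : ∀ {n} → Pred (Vector Carrier n) 0ℓ
  UnitCube x = ∀ i → 0# ≤ x i × x i ≤ 1#

  Face : ∀ {n} → Pred (Vector Carrier n) 0ℓ →
         Vector Carrier n → Carrier → Pred (Vector Carrier n) 0ℓ
  Face P a b x = P x × a · x ≈ b

  -- a · x ≤ b is valid for P, and its face is neither empty nor all of P.
  ProperFace : ∀ {n} → Pred (Vector Carrier n) 0ℓ →
               Vector Carrier n → Carrier → Set
  ProperFace P a b =
    (∀ x → P x → a · x ≤ b) × ∃ (Face P a b) × ∃[ x ] P x × ¬ a · x ≈ b

  -- A facet is an inclusionwise maximal proper face.
  Facet : ∀ {n} → Pred (Vector Carrier n) 0ℓ → Vector Carrier n → Carrier → Set
  Facet P a b = ProperFace P a b ×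
    (∀ c d → ProperFace P c d → Face P a b ⊆ Face P c d → Face P c d ⊆ Face P a b)

  ----------------------------------------------------------------------
  -- The Lovász–Schrijver PSD-operator

  -- Coordinate zero is the homogenising coordinate x₀.
  Cone : ∀ {n} → Pred (Vector Carrier n) 0ℓ → Pred (Vector Carrier (ℕ.suc n)) 0ℓ
  Cone {n} K x = Σ (Vector Carrier n) λ y → K y × (∀ i → x (suc i) ≈ x zero * y i)

  Matrix : ℕ → Set
  Matrix n = Fin n → Fin n → Carrier

  PositiveSemidefinite : ∀ {n} → Matrix n → Set
  PositiveSemidefinite {n} Y =
    (∀ i j → Y i j ≈ Y j i) ×
    (∀ (v : Vector Carrier n) → 0# ≤ sum λ i → sum λ j → v i * Y i j * v j)

  record M₊ {n} (K : Pred (Vector Carrier n) 0ℓ) (Y : Matrix (ℕ.suc n)) : Set where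
    field
      positiveSemidefinite : PositiveSemidefinite Y
      diagonal             : ∀ k → Y k zero ≈ Y k k
      column               : ∀ i → Cone K λ k → Y k (suc i)
      columnComplement     : ∀ i → Cone K λ k → Y k zero - Y k (suc i)

  LS₊ : ∀ {n} → Pred (Vector Carrier n) 0ℓ → Pred (Vector Carrier n) 0ℓ
  LS₊ {n} K x = UnitCube x ×
    Σ (Matrix (ℕ.suc n)) λ Y → M₊ K Y × (∀ k → (1# ∷ x) k ≈ Y k zero)

  ----------------------------------------------------------------------
  -- Polyhedra of a graph

  module _ {n} (G : Graph n) where
    open Graph G

    incidence : Subset n → Vector Carrier n
    incidence S i = if lookup S i then 1# else 0#

    STAB : Pred (Vector Carrier n) 0ℓ
    STAB = ConvexHull λ x → ∃[ S ] Stable G S × (∀ i → x i ≈ incidence S i)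

    ESTAB : Pred (Vector Carrier n) 0ℓ
    ESTAB x = UnitCube x × (∀ i j → i ∼ j → x i + x j ≤ 1#)

    FacetDefining : Set
    FacetDefining = Σ (Vector Carrier n) λ a → ∃[ b ]
      Facet STAB a b × (∀ i → ¬ a i ≈ 0#)

    LS₊-Perfect : Set
    LS₊-Perfect = LS₊ ESTAB ≐ STAB

    LS₊-Imperfect : Set
    LS₊-Imperfect = ¬ LS₊-Perfect

{-# OPTIONS --safe #-}
-- Suppose G is LS₊-perfect.  LS₊-imperfection passes from an induced subgraph to G by
-- padding a witness matrix with zeros, so G contains none of three small graphs: a
-- 5-cycle with a vertex adjacent to three consecutive (G_LT) or to four (G_EMN) of its
-- vertices, and a prism with two of its three connecting edges subdivided once.  By
-- Fouquet's argument some vertex is the hub of an induced 5-wheel a b c d e.  Every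
-- other vertex is then a hub, an ear over one of the rim edges, or far from the rim, and
-- G is a blow-up of an induced subgraph of the icosahedron.
--
-- For a facet with full support, every clique with a non-neighbour of one of its members
-- is missed by some tight stable set, since otherwise the facet would be the face
-- x(K) = 1; hence no vertex is simplicial.  The same holds for the wheel inequality
-- 2 x(hubs) + x(rim) ≤ 2.  A far vertex gives a prism or is simplicial, four ears give a
-- prism, and an isolated ear is simplicial.  In the remaining cases of two or three
-- consecutive ears, exchanging vertices in the tight stable sets obtained from suitable
-- cliques and from the wheel yields contradictory inequalities between the coefficients.
module Submission where

open import Defs
open import Data.Nat.Base using (ℕ)
open import Relation.Nullary using (¬_)

open import Algebra.Bundles using (CommutativeRing)
open import Algebra.Solver.Ring.AlmostCommutativeRing using (_-Raw-AlmostCommutative⟶_; fromCommutativeRing)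
open import Data.Bool.Base using (Bool; T; true; false; if_then_else_; _∧_; _∨_)
open import Data.Bool.ListAction using (any)
open import Data.Bool.Properties using (∨-comm; T?)
open import Data.Empty using (⊥; ⊥-elim)
open import Data.Fin using (#_)
open import Data.Fin.Base using (Fin; zero; suc; toℕ)
import Data.Fin.Properties as Finₚ
open import Data.Fin.Subset as Subset using (Subset; _∈_; _∉_; _∪_; _∩_; ∁; ⁅_⁆; ∣_∣; Empty)
open import Data.Fin.Subset.Properties
  using ( _∈?_; anySubset?; ∉⊥; x∈⁅x⁆; x∈⁅y⁆⇒x≡y; x∈p∪q⁻; x∈p∪q⁺; x∈p∩q⁻; x∈p∩q⁺; x∈∁p⇒x∉p; x∉p⇒x∈∁p
        ; x∈p∧x≢y⇒x∈p-y; x∈p⇒∣p-x∣<∣p∣; ⊆-antisym )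
open import Data.Integer.Base as ℤ using (ℤ; +_; -[1+_])
import Data.Integer.Properties as ℤₚ
open import Data.List.Base using (List; []; _∷_)
open import Data.Maybe.Base as Maybe using (Maybe; just; nothing)
import Data.Nat.Base as ℕ
import Data.Nat.Properties as ℕₚ
open import Data.Product.Base using (∃; ∃-syntax; _×_; _,_; proj₁; proj₂)
import Data.Sign.Base as Sign
open import Data.Sum.Base using (_⊎_; inj₁; inj₂; [_,_]′)
open import Data.Unit.Base using (⊤; tt)
open import Data.Vec.Base using (Vec; []; _∷_; lookup; tabulate; here; there)
open import Data.Vec.Functional using (Vector)
open import Data.Vec.Properties using ([]=⇒lookup; lookup⇒[]=; lookup∘tabulate)
open import Function.Base using (_∘_; const)
open import Level using (0ℓ)
open import Relation.Binary.Bundles using (Poset)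
open import Relation.Binary.Definitions using () renaming (Decidable to Decidable₂)
open import Relation.Binary.PropositionalEquality.Core as ≡ using (_≡_; _≢_; refl)
open import Relation.Binary.Structures using (IsDecTotalOrder)
open import Relation.Nullary using (yes; no; Dec; does)
open import Relation.Nullary.Decidable
  using (_×-dec_; _⊎-dec_; _→-dec_; ¬?; True; toWitness; dec⇒maybe; dec-true; dec-false; decidable-stable)
open import Relation.Unary using (Pred; Decidable)

import Algebra.Properties.CommutativeMonoid.Sum ℤₚ.+-0-commutativeMonoid as ℤΣ

-- Full support acts through positivity. All coefficients of the facet turn out positive, so tight
-- stable sets are maximal: a vertex outside one has a neighbour inside. This also excludes clique
-- and wheel faces: a single vertex of the clique, or a single hub, would then be tight, although a
-- non-neighbour can be added to it. The missing tight set is thus found by contradiction and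
-- offered as a double negation; every goal it serves is `⊥`.
--
-- An exchange removes a vertex x from a tight set and inserts a stable set whose only neighbour
-- there is x; the inserted weight is at most that of x. Writing vertices for their coefficients,
-- the clash for two ears is c + e ≤ d ≤ e. For three ears it is t₁ + e ≤ a against a + d ≤ s ≤ e
-- with s a hub or e itself, or t₂ + d ≤ t₃ against t₃ + e ≤ d.
--
-- Perfection is used only to exclude the three small graphs. Their witness matrices are integral,
-- with positive semidefiniteness reduced to an identity of weighted squares, so that evaluation
-- over ℤ settles everything and the result is carried into the field.

-- Ordered field arithmetic and the image of ℤ in the field.

module OrderedField (ℝ : CompleteOrderedField) where
  open CompleteOrderedField ℝ public
  open CommutativeRing commutativeRing
    public using ( ring; semiring; setoid; +-cong; +-congˡ; +-congʳ; *-congˡ; *-congʳ; -‿cong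
          ; +-comm; *-comm; *-assoc; +-identityˡ; +-identityʳ; *-identityˡ; *-identityʳ; zeroˡ; zeroʳ; -‿inverseʳ;
            distribˡ)
    renaming (refl to ≈-refl; sym to ≈-sym; trans to ≈-trans; reflexive to ≈-reflexive)
  open import Algebra.Properties.Ring ring
    public using (-‿involutive; -‿distribˡ-*; -‿distribʳ-*; -0#≈0#; -‿+-comm)
  open import Algebra.Properties.Semiring.Sum semiring public
  open import Algebra.Properties.Semiring.Mult semiring
    public using (×1-homo-*; ×-homo-+) renaming (_×_ to _⊠_)

  open IsDecTotalOrder isDecTotalOrder public
    using (_≟_; _≤?_; total; antisym)
    renaming (refl to ≤-refl; trans to ≤-trans; reflexive to ≤-reflexive)

  -- Serves twice: as coefficient ring of the ring solver, and as the bridge by which facts computed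
  -- over ℤ reach the field.
  ι : ℤ → Carrier
  ι (+ n)    = n ⊠ 1#
  ι -[1+ n ] = - (ℕ.suc n ⊠ 1#)

  ι-⊖ : ∀ m n → ι (m ℤ.⊖ n) ≈ m ⊠ 1# - n ⊠ 1#
  ι-⊖ ℕ.zero ℕ.zero    = ≈-sym (≈-trans (+-identityˡ _) -0#≈0#)
  ι-⊖ ℕ.zero (ℕ.suc n) = ≈-sym (+-identityˡ _)
  ι-⊖ (ℕ.suc m) ℕ.zero = ≈-sym (≈-trans (+-congˡ -0#≈0#) (+-identityʳ _))
  ι-⊖ (ℕ.suc m) (ℕ.suc n) = begin
    ι (ℕ.suc m ℤ.⊖ ℕ.suc n)            ≡⟨ ≡.cong ι (ℤₚ.[1+m]⊖[1+n]≡m⊖n m n) ⟩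
    ι (m ℤ.⊖ n)                        ≈⟨ ι-⊖ m n ⟩
    m ⊠ 1# - n ⊠ 1#                    ≈⟨ +-identityˡ _ ⟨
    0# + (m ⊠ 1# - n ⊠ 1#)             ≈⟨ +-congʳ (-‿inverseʳ 1#) ⟨
    (1# - 1#) + (m ⊠ 1# - n ⊠ 1#)      ≈⟨ interchange 1# (- 1#) (m ⊠ 1#) (- (n ⊠ 1#)) ⟩
    (1# + m ⊠ 1#) + (- 1# - n ⊠ 1#)    ≈⟨ +-congˡ (-‿+-comm 1# (n ⊠ 1#)) ⟩
    ℕ.suc m ⊠ 1# - ℕ.suc n ⊠ 1#        ∎
    where
    open import Relation.Binary.Reasoning.Setoid setoid
    open import Algebra.Properties.CommutativeSemigroup
      (CommutativeRing.+-commutativeSemigroup commutativeRing) using (interchange)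

  ι-+ : ∀ i j → ι (i ℤ.+ j) ≈ ι i + ι j
  ι-+ (+ m)    (+ n)    = ×-homo-+ 1# m n
  ι-+ (+ m)    -[1+ n ] = ι-⊖ m (ℕ.suc n)
  ι-+ -[1+ m ] (+ n)    = ≈-trans (ι-⊖ n (ℕ.suc m)) (+-comm _ _)
  ι-+ -[1+ m ] -[1+ n ] = ≈-trans
    (-‿cong (≈-trans (≈-reflexive (≡.cong (λ k → ℕ.suc k ⊠ 1#) (≡.sym (ℕₚ.+-suc m n))))
      (×-homo-+ 1# (ℕ.suc m) (ℕ.suc n))))
    (≈-sym (-‿+-comm _ _))

  ι-neg : ∀ i → ι (ℤ.- i) ≈ - ι i
  ι-neg (+ ℕ.zero)    = ≈-sym -0#≈0#
  ι-neg (+ (ℕ.suc n)) = ≈-refl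
  ι-neg -[1+ n ]      = ≈-sym (-‿involutive _)

  ι-neg◃ : ∀ n → ι (Sign.- ℤ.◃ n) ≈ - (n ⊠ 1#)
  ι-neg◃ ℕ.zero    = ≈-sym -0#≈0#
  ι-neg◃ (ℕ.suc n) = ≈-refl

  ι-* : ∀ i j → ι (i ℤ.* j) ≈ ι i * ι j
  ι-* (+ m)    (+ n)    = ≈-trans (≈-reflexive (≡.cong ι (ℤₚ.+◃n≡+n (m ℕ.* n)))) (×1-homo-* m n)
  ι-* (+ m)    -[1+ n ] = ≈-trans (ι-neg◃ (m ℕ.* ℕ.suc n))
    (≈-trans (-‿cong (×1-homo-* m (ℕ.suc n))) (-‿distribʳ-* _ _))
  ι-* -[1+ m ] (+ n)    = ≈-trans (ι-neg◃ (ℕ.suc m ℕ.* n))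
    (≈-trans (-‿cong (×1-homo-* (ℕ.suc m) n)) (-‿distribˡ-* _ _))
  ι-* -[1+ m ] -[1+ n ] = ≈-trans (×1-homo-* (ℕ.suc m) (ℕ.suc n))
    (≈-sym (≈-trans (≈-sym (-‿distribˡ-* _ _))
           (≈-trans (-‿cong (≈-sym (-‿distribʳ-* _ _))) (-‿involutive _))))

  ι-1 : ι (+ 1) ≈ 1#
  ι-1 = +-identityʳ 1#

  ι-morphism : ℤ.+-*-rawRing -Raw-AlmostCommutative⟶ fromCommutativeRing commutativeRing
  ι-morphism = record { ⟦_⟧ = ι ; +-homo = ι-+ ; *-homo = ι-* ; -‿homo = ι-neg ; 0-homo = ≈-refl ; 1-homo = ι-1 }

  ι-≟ : ∀ i j → Maybe (ι i ≈ ι j)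
  ι-≟ i j = Maybe.map (λ i≡j → ≈-reflexive (≡.cong ι i≡j)) (dec⇒maybe (i ℤₚ.≟ j))

  open import Algebra.Solver.Ring ℤ.+-*-rawRing (fromCommutativeRing commutativeRing) ι-morphism ι-≟
    public using (solve; _:=_; _:+_; _:*_; _:-_; :-_)

  poset : Poset _ _ _
  poset = record { isPartialOrder = IsDecTotalOrder.isPartialOrder isDecTotalOrder }

  +-mono-≤ : ∀ {x y u v} → x ≤ y → u ≤ v → x + u ≤ y + v
  +-mono-≤ {x} {y} {u} {v} x≤y u≤v = ≤-trans (+-monoˡ-≤ u x≤y)
    (≤-trans (≤-reflexive (+-comm y u)) (≤-trans (+-monoˡ-≤ y u≤v) (≤-reflexive (+-comm v y))))

  +-cancelʳ-≤ : ∀ z {x y} → x + z ≤ y + z → x ≤ y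
  +-cancelʳ-≤ z {x} {y} p = ≤-trans (≤-reflexive (cancel x))
    (≤-trans (+-monoˡ-≤ (- z) p) (≤-reflexive (≈-sym (cancel y))))
    where
    cancel : ∀ w → w ≈ w + z - z
    cancel w = solve 2 (λ w z → w := w :+ z :- z) ≈-refl w z

  +-cancelʳ-≈ : ∀ z {x y} → x + z ≈ y + z → x ≈ y
  +-cancelʳ-≈ z p = antisym (+-cancelʳ-≤ z (≤-reflexive p)) (+-cancelʳ-≤ z (≤-reflexive (≈-sym p)))

  ≤⇒0≤- : ∀ {x y} → x ≤ y → 0# ≤ y - x
  ≤⇒0≤- {x} {y} x≤y = ≤-trans (≤-reflexive (≈-sym (-‿inverseʳ x))) (+-monoˡ-≤ (- x) x≤y)

  0≤-⇒≤ : ∀ {x y} → 0# ≤ y - x → x ≤ y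
  0≤-⇒≤ {x} {y} p = +-cancelʳ-≤ (- x) (≤-trans (≤-reflexive (-‿inverseʳ x)) p)

  ≤0⇒0≤- : ∀ {x} → x ≤ 0# → 0# ≤ - x
  ≤0⇒0≤- p = ≤-trans (≤⇒0≤- p) (≤-reflexive (+-identityˡ _))

  *-monoʳ-≤ : ∀ {c x y} → 0# ≤ c → x ≤ y → c * x ≤ c * y
  *-monoʳ-≤ {c} {x} {y} 0≤c x≤y = 0≤-⇒≤ (≤-trans (*-nonNegative 0≤c (≤⇒0≤- x≤y))
    (≤-reflexive (solve 3 (λ c x y → c :* (y :- x) := c :* y :- c :* x) ≈-refl c x y)))

  0≤x² : ∀ x → 0# ≤ x * x
  0≤x² x with total 0# x
  ... | inj₁ 0≤x = *-nonNegative 0≤x 0≤x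
  ... | inj₂ x≤0 = ≤-trans (*-nonNegative (≤0⇒0≤- x≤0) (≤0⇒0≤- x≤0))
    (≤-reflexive (solve 1 (λ x → (:- x) :* (:- x) := x :* x) ≈-refl x))

  0≤1 : 0# ≤ 1#
  0≤1 = ≤-trans (0≤x² 1#) (≤-reflexive (*-identityˡ 1#))

  x+y≤x⇒y≤0 : ∀ {x y} → x + y ≤ x → y ≤ 0#
  x+y≤x⇒y≤0 {x} {y} p = +-cancelʳ-≤ x
    (≤-trans (≤-reflexive (+-comm y x)) (≤-trans p (≤-reflexive (≈-sym (+-identityˡ x)))))

  *-≈0 : ∀ {x y} → x * y ≈ 0# → ¬ x ≈ 0# → y ≈ 0#
  *-≈0 {x} {y} xy≈0 x≉0 with inverse x x≉0
  ... | z , xz≈1 = ≈-trans (≈-sym (*-identityˡ y)) (≈-trans (*-congʳ (≈-sym xz≈1))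
    (≈-trans (solve 3 (λ x y z → x :* z :* y := z :* (x :* y)) ≈-refl x y z) (≈-trans (*-congˡ xy≈0) (zeroʳ z))))

  inverse-nonNegative : ∀ {x y} → 0# ≤ x → x * y ≈ 1# → 0# ≤ y
  inverse-nonNegative {x} {y} 0≤x xy≈1 =
    ≤-trans (*-nonNegative 0≤x (0≤x² y)) (≤-reflexive (≈-trans (≈-sym (*-assoc x y y))
    (≈-trans (*-congʳ xy≈1) (*-identityˡ y))))

  ι-nonNegative : ∀ {i} → + 0 ℤ.≤ i → 0# ≤ ι i
  ι-nonNegative {+ n} _ = go n
    where
    go : ∀ n → 0# ≤ n ⊠ 1#
    go ℕ.zero    = ≤-refl
    go (ℕ.suc n) = ≤-trans (≤-reflexive (≈-sym (+-identityˡ 0#))) (+-mono-≤ 0≤1 (go n))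

  ι-minus : ∀ i j → ι (i ℤ.- j) ≈ ι i - ι j
  ι-minus i j = ≈-trans (ι-+ i (ℤ.- j)) (+-congˡ (ι-neg j))

  ι-mono-≤ : ∀ {i j} → i ℤ.≤ j → ι i ≤ ι j
  ι-mono-≤ {i} {j} i≤j = 0≤-⇒≤ (≤-trans (ι-nonNegative (ℤₚ.i≤j⇒0≤j-i i≤j)) (≤-reflexive (ι-minus j i)))

  -- The field carries only `≤`, so strictness is a negated inequality; `i + 1 ≤ j` together with
  -- the converse would give `1# ≤ 0#`.
  ι-mono-< : ∀ {i j} → i ℤ.< j → ¬ ι j ≤ ι i
  ι-mono-< {i} {j} i<j j≤i = 0≉1 (antisym 0≤1 (x+y≤x⇒y≤0 (≤-trans (≤-reflexive (+-comm (ι i) 1#))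
    (≤-trans (≤-reflexive (≈-trans (+-congʳ (≈-sym ι-1)) (≈-sym (ι-+ (+ 1) i))))
    (≤-trans (ι-mono-≤ (ℤₚ.i<j⇒suc[i]≤j i<j)) j≤i)))))

  sum-nonNegative : ∀ {n} {x : Vector Carrier n} → (∀ i → 0# ≤ x i) → 0# ≤ sum x
  sum-nonNegative {ℕ.zero}  p = ≤-refl
  sum-nonNegative {ℕ.suc n} p = ≤-trans (≤-reflexive (≈-sym (+-identityˡ 0#)))
    (+-mono-≤ (p zero) (sum-nonNegative (p ∘ suc)))

  sum-mono-≤ : ∀ {n} {x y : Vector Carrier n} → (∀ i → x i ≤ y i) → sum x ≤ sum y
  sum-mono-≤ {ℕ.zero}  p = ≤-refl
  sum-mono-≤ {ℕ.suc n} p = +-mono-≤ (p zero) (sum-mono-≤ (p ∘ suc))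

  sum-≈0 : ∀ {n} {x : Vector Carrier n} → (∀ i → 0# ≤ x i) → sum x ≈ 0# → ∀ i → x i ≈ 0#
  sum-≈0 {ℕ.suc n} {x} p s zero = antisym (≤-trans (≤-trans (≤-reflexive (≈-sym (+-identityʳ _)))
    (+-mono-≤ ≤-refl (sum-nonNegative (p ∘ suc)))) (≤-reflexive s)) (p zero)
  sum-≈0 {ℕ.suc n} {x} p s (suc i) = sum-≈0 (p ∘ suc) (antisym (≤-trans (≤-trans (≤-reflexive (≈-sym (+-identityˡ _)))
    (+-mono-≤ (p zero) ≤-refl)) (≤-reflexive s)) (sum-nonNegative (p ∘ suc))) i

  ι-sum : ∀ {n} (x : Fin n → ℤ) → ι (ℤΣ.sum x) ≈ sum (ι ∘ x)
  ι-sum {ℕ.zero}  x = ≈-refl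
  ι-sum {ℕ.suc n} x = ≈-trans (ι-+ (x zero) _) (+-congˡ (ι-sum (x ∘ suc)))

-- Convex hulls, faces and weights of vertex sets.

module Polyhedra (ℝ : CompleteOrderedField) where
  open OrderedField ℝ
  infixl 7 _∙_
  infixl 5 _∖_

  _∖_ : ∀ {n} → Subset n → Fin n → Subset n
  S ∖ x = S ∩ ∁ ⁅ x ⁆

  ∖⁻ : ∀ {n} {S : Subset n} {x i} → i ∈ S ∖ x → i ∈ S × i ≢ x
  ∖⁻ {S = S} {x} i∈ with x∈p∩q⁻ S (∁ ⁅ x ⁆) i∈
  ... | i∈S , i∈∁ = i∈S , λ { refl → x∈∁p⇒x∉p i∈∁ (x∈⁅x⁆ x) }

  ∖⁺ : ∀ {n} {S : Subset n} {x i} → i ∈ S → i ≢ x → i ∈ S ∖ x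
  ∖⁺ {S = S} {x} i∈S i≢x = x∈p∩q⁺ (i∈S , x∉p⇒x∈∁p (i≢x ∘ x∈⁅y⁆⇒x≡y x))

  sum-single : ∀ {n} {t : Vector Carrier n} x → (∀ i → i ≢ x → t i ≈ 0#) → sum t ≈ t x
  sum-single {ℕ.suc n} zero z = ≈-trans (+-congˡ (≈-trans (sum-cong-≋ λ i → z (suc i) λ ()) (sum-replicate-zero n)))
    (+-identityʳ _)
  sum-single (suc x) z = ≈-trans (+-cong (z zero λ ()) (sum-single x λ i i≢x → z (suc i) (i≢x ∘ Finₚ.suc-injective)))
    (+-identityˡ _)

  _∙_ : ∀ {n} → Vector Carrier n → Vector Carrier n → Carrier
  _∙_ = _·_ ℝ

  ∙-congˡ : ∀ {n} (a : Vector Carrier n) {x y} → (∀ i → x i ≈ y i) → a ∙ x ≈ a ∙ y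
  ∙-congˡ a x≈y = sum-cong-≋ λ i → *-congˡ (x≈y i)

  module _ {n} {X : Pred (Vector Carrier n) 0ℓ} where

    ∙-combination : ∀ a {x} ((m , c , p , _) : ConvexHull ℝ X x) → a ∙ x ≈ sum λ k → c k * (a ∙ p k)
    ∙-combination a {x} (m , c , p , _ , _ , _ , x≈) = begin
      a ∙ x                                    ≈⟨ ∙-congˡ a x≈ ⟩
      (sum λ i → a i * sum λ k → c k * p k i)  ≈⟨ sum-cong-≋ (λ i → *-distribˡ-sum {m} (a i) (λ k → c k * p k i)) ⟩
      (sum λ i → sum λ k → a i * (c k * p k i))≈⟨ ∑-comm {n} {m} _ ⟩
      (sum λ k → sum λ i → a i * (c k * p k i))
        ≈⟨ sum-cong-≋ (λ k → ≈-trans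
             (sum-cong-≋ {n} λ i → solve 3 (λ a c p → a :* (c :* p) := c :* (a :* p)) ≈-refl (a i) (c k) (p k i))
             (≈-sym (*-distribˡ-sum {n} (c k) (λ i → a i * p k i)))) ⟩
      (sum λ k → c k * (a ∙ p k))              ∎
      where open import Relation.Binary.Reasoning.Setoid setoid

    sum-weights : ∀ e {x} ((m , c , _) : ConvexHull ℝ X x) → (sum λ k → c k * e) ≈ e
    sum-weights e (m , c , _ , _ , ∑c≈1 , _) =
      ≈-trans (≈-sym (*-distribʳ-sum e c)) (≈-trans (*-congʳ ∑c≈1) (*-identityˡ e))

    hull-≤ : ∀ a {b} → (∀ p → X p → a ∙ p ≤ b) → ∀ x → ConvexHull ℝ X x → a ∙ x ≤ b
    hull-≤ a {b} valid x h@(_ , c , p , 0≤c , _ , p∈X , _) =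
      ≤-trans (≤-reflexive (∙-combination a h))
        (≤-trans (sum-mono-≤ λ k → *-monoʳ-≤ (0≤c k) (valid (p k) (p∈X k))) (≤-reflexive (sum-weights b h)))

    -- A tight point is a convex combination of tight points.
    hull-face : ∀ a {b} d {e} → (∀ p → X p → a ∙ p ≤ b) → (∀ p → X p → a ∙ p ≈ b → d ∙ p ≈ e) →
                ∀ {x} → ConvexHull ℝ X x → a ∙ x ≈ b → d ∙ x ≈ e
    hull-face a {b} d {e} valid tight {x} h@(_ , c , p , 0≤c , _ , p∈X , _) ax≈b =
      ≈-trans (∙-combination d h) (≈-trans (sum-cong-≋ term) (sum-weights e h))
      where
      slack : ∀ k → c k * (b - a ∙ p k) ≈ 0#
      slack = sum-≈0 (λ k → *-nonNegative (0≤c k) (≤⇒0≤- (valid (p k) (p∈X k))))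
        (+-cancelʳ-≈ (sum λ k → c k * (a ∙ p k)) (begin
          (sum λ k → c k * (b - a ∙ p k)) + (sum λ k → c k * (a ∙ p k))
            ≈⟨ ∑-distrib-+ (λ k → c k * (b - a ∙ p k)) _ ⟨
          (sum λ k → c k * (b - a ∙ p k) + c k * (a ∙ p k))
            ≈⟨ sum-cong-≋ (λ k → solve 3 (λ c b y → c :* (b :- y) :+ c :* y := c :* b) ≈-refl (c k) b (a ∙ p k)) ⟩
          (sum λ k → c k * b)                   ≈⟨ sum-weights b h ⟩
          b                                     ≈⟨ ax≈b ⟨
          a ∙ x                                 ≈⟨ ∙-combination a h ⟩
          (sum λ k → c k * (a ∙ p k))           ≈⟨ +-identityˡ _ ⟨
          0# + (sum λ k → c k * (a ∙ p k))      ∎))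
        where open import Relation.Binary.Reasoning.Setoid setoid
      -- A point with coefficient zero need not be tight, but it contributes nothing to either side.
      term : ∀ k → c k * (d ∙ p k) ≈ c k * e
      term k with c k ≟ 0#
      ... | yes c≈0 = ≈-trans (*-congʳ c≈0) (≈-trans (zeroˡ _) (≈-sym (≈-trans (*-congʳ c≈0) (zeroˡ _))))
      ... | no c≉0  = *-congˡ (tight (p k) (p∈X k)
        (≈-sym (+-cancelʳ-≈ (- (a ∙ p k)) (≈-trans (*-≈0 (slack k) c≉0) (≈-sym (-‿inverseʳ _))))))

  module _ {n} (G : Graph n) where
    open Graph G

    inc : Subset n → Vector Carrier n
    inc = incidence ℝ G

    inc-∈ : ∀ {S i} → i ∈ S → inc S i ≡ 1#
    inc-∈ i∈S = ≡.cong (if_then 1# else 0#) ([]=⇒lookup i∈S)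

    inc-∉ : ∀ {S i} → i ∉ S → inc S i ≡ 0#
    inc-∉ {S} {i} i∉S with lookup S i in eq
    ... | true  = ⊥-elim (i∉S (lookup⇒[]= i S eq))
    ... | false = refl

    module _ (d : Vector Carrier n) where

      weight : Subset n → Carrier
      weight S = d ∙ inc S

      -- The disjoint union is described by membership, so that the same lemma serves unions and
      -- deletions without set equations.
      weight-add : ∀ {U S T} → (∀ {i} → i ∈ U → i ∈ S ⊎ i ∈ T) → (∀ {i} → i ∈ S → i ∈ U × i ∉ T) →
                   (∀ {i} → i ∈ T → i ∈ U) → weight U ≈ weight S + weight T
      weight-add {U} {S} {T} split S⊆ T⊆ =
        ≈-trans (sum-cong-≋ λ i → ≈-trans (*-congˡ (pointwise i)) (distribˡ (d i) _ _)) (∑-distrib-+ {n} _ _)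
        where
        pointwise : ∀ i → inc U i ≈ inc S i + inc T i
        pointwise i with i ∈? S | i ∈? T
        ... | yes s | yes t = ⊥-elim (proj₂ (S⊆ s) t)
        ... | yes s | no ¬t rewrite inc-∈ s | inc-∉ ¬t | inc-∈ (proj₁ (S⊆ s)) = ≈-sym (+-identityʳ _)
        ... | no ¬s | yes t rewrite inc-∉ ¬s | inc-∈ t | inc-∈ (T⊆ t) = ≈-sym (+-identityˡ _)
        ... | no ¬s | no ¬t rewrite inc-∉ ¬s | inc-∉ ¬t | inc-∉ {U} ([ ¬s , ¬t ]′ ∘ split) = ≈-sym (+-identityˡ _)

      weight-≈0 : ∀ {S} → (∀ {i} → i ∈ S → d i ≈ 0#) → weight S ≈ 0#
      weight-≈0 {S} z = ≈-trans (sum-cong-≋ pointwise) (sum-replicate-zero n)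
        where
        pointwise : ∀ i → d i * inc S i ≈ 0#
        pointwise i with i ∈? S
        ... | yes s = ≈-trans (*-congʳ (z s)) (zeroˡ _)
        ... | no ¬s rewrite inc-∉ ¬s = zeroʳ _

      weight-⊥ : weight Subset.⊥ ≈ 0#
      weight-⊥ = weight-≈0 (⊥-elim ∘ ∉⊥)

      weight-⁅⁆ : ∀ x → weight ⁅ x ⁆ ≈ d x
      weight-⁅⁆ x = ≈-trans (sum-single x λ i i≢x → ≈-trans (*-congˡ (≈-reflexive (inc-∉ (i≢x ∘ x∈⁅y⁆⇒x≡y x))))
        (zeroʳ _))
        (≈-trans (*-congˡ (≈-reflexive (inc-∈ (x∈⁅x⁆ x)))) (*-identityʳ _))

      weight-∪ : ∀ {S T} → (∀ {i} → i ∈ S → i ∉ T) → weight (S ∪ T) ≈ weight S + weight T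
      weight-∪ {S} {T} disjoint = weight-add (x∈p∪q⁻ S T) (λ s → x∈p∪q⁺ (inj₁ s) , disjoint s) (x∈p∪q⁺ ∘ inj₂)

      weight-∖ : ∀ {S x} → x ∈ S → weight S ≈ weight (S ∖ x) + d x
      weight-∖ {S} {x} x∈S = ≈-trans
        (weight-add split (λ i∈ → proj₁ (∖⁻ {S = S} {x} i∈) , proj₂ (∖⁻ {S = S} {x} i∈) ∘ x∈⁅y⁆⇒x≡y x)
           (λ i∈ → ≡.subst (_∈ S) (≡.sym (x∈⁅y⁆⇒x≡y x i∈)) x∈S))
        (+-congˡ (weight-⁅⁆ x))
        where
        split : ∀ {i} → i ∈ S → i ∈ S ∖ x ⊎ i ∈ ⁅ x ⁆
        split {i} i∈S with i Finₚ.≟ x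
        ... | yes refl = inj₂ (x∈⁅x⁆ x)
        ... | no i≢x   = inj₁ (∖⁺ i∈S i≢x)

      weight-only : ∀ {S x} → x ∈ S → (∀ {i} → i ∈ S → i ≢ x → d i ≈ 0#) → weight S ≈ d x
      weight-only {S} {x} x∈S z = ≈-trans (weight-∖ x∈S)
        (≈-trans (+-congʳ (weight-≈0 λ i∈ → z (proj₁ (∖⁻ {S = S} {x} i∈)) (proj₂ (∖⁻ {S = S} {x} i∈))))
          (+-identityˡ _))

    IncidenceVector : Pred (Vector Carrier n) _
    IncidenceVector x = ∃[ S ] Stable G S × (∀ i → x i ≈ inc S i)

    onIncidence : ∀ {ℓ} {P : Carrier → Set ℓ} d → (∀ {x y} → x ≈ y → P y → P x) →
                  (∀ S → Stable G S → P (weight d S)) → ∀ x → IncidenceVector x → P (d ∙ x)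
    onIncidence d resp p x (S , S-stable , x≈) = resp (∙-congˡ d x≈) (p S S-stable)

    stable⇒STAB : ∀ {S} → Stable G S → STAB ℝ G (inc S)
    stable⇒STAB {S} S-stable = 1 , const 1# , const (inc S) , const 0≤1 , +-identityʳ 1# ,
      (λ _ → S , S-stable , λ _ → ≈-refl) , λ i → ≈-sym (≈-trans (+-identityʳ _) (*-identityˡ _))

    ⊥-stable : Stable G Subset.⊥
    ⊥-stable i _ i∈⊥ = ⊥-elim (∉⊥ i∈⊥)

    ⁅⁆-stable : ∀ x → Stable G ⁅ x ⁆
    ⁅⁆-stable x i j i∈ j∈ i∼j with x∈⁅y⁆⇒x≡y x i∈ | x∈⁅y⁆⇒x≡y x j∈
    ... | refl | refl = ∼-irrefl refl i∼j

    -- Tight stable sets of a facet: maximality, exchange, missed cliques and wheels.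

    module Facets {a : Vector Carrier n} {b} (facet : Facet ℝ (STAB ℝ G) a b) where

      valid : ∀ {S} → Stable G S → weight a S ≤ b
      valid S-stable = proj₁ (proj₁ facet) _ (stable⇒STAB S-stable)

      Tight : Subset n → Set
      Tight S = Stable G S × weight a S ≈ b

      -- Maximality of the facet, reduced to stable sets: the face cut out by `d` contains the facet
      -- because tight points are combinations of tight stable sets, and `T` keeps it proper, so the
      -- two faces coincide.
      facet-exhausts : ∀ {d e} → (∀ S → Stable G S → weight d S ≤ e) → (∀ S → Tight S → weight d S ≈ e) →
                       ∃[ S ] Stable G S × ¬ weight d S ≈ e → ∀ S → Stable G S → weight d S ≈ e → weight a S ≈ b
      facet-exhausts {d} {e} d-valid tight (T , T-stable , T≉) S S-stable S≈ =
        proj₂ (proj₂ facet d e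
          ( hull-≤ d (onIncidence d (≤-trans ∘ ≤-reflexive) d-valid)
          , (proj₁ nonempty , face⊆ (proj₂ nonempty))
          , (inc T , stable⇒STAB T-stable , T≉))
          face⊆ (stable⇒STAB S-stable , S≈))
        where
        nonempty = proj₁ (proj₂ (proj₁ facet))
        face⊆ : ∀ {x} → Face ℝ (STAB ℝ G) a b x → Face ℝ (STAB ℝ G) d e x
        face⊆ (x∈ , ax≈b) = x∈ , hull-face a d (onIncidence a (≤-trans ∘ ≤-reflexive) (λ _ → valid))
          (λ { p (S , S-stable , p≈) ap≈b → ≈-trans (∙-congˡ d p≈)
               (tight S (S-stable , ≈-trans (≈-sym (∙-congˡ a p≈)) ap≈b)) }) x∈ ax≈b

      module FullFacet (a≉0 : ∀ i → ¬ a i ≈ 0#) (other : ∀ (i : Fin n) → ∃ λ (j : Fin n) → j ≢ i) where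

        private
          insert-stable : ∀ {S T} → Stable G S → Stable G T → (∀ {i j} → i ∈ S → j ∈ T → ¬ i ∼ j) → Stable G (S ∪ T)
          insert-stable {S} {T} S-stable T-stable apart i j i∈ j∈ i∼j with x∈p∪q⁻ S T i∈ | x∈p∪q⁻ S T j∈
          ... | inj₁ p | inj₁ q = S-stable i j p q i∼j
          ... | inj₁ p | inj₂ q = apart p q i∼j
          ... | inj₂ p | inj₁ q = apart q p (∼-sym i∼j)
          ... | inj₂ p | inj₂ q = T-stable i j p q i∼j

          ∖-stable : ∀ {S x} → Stable G S → Stable G (S ∖ x)
          ∖-stable {S} {x} S-stable i j i∈ j∈ = S-stable i j (proj₁ (∖⁻ {S = S} {x} i∈)) (proj₁ (∖⁻ {S = S} {x} j∈))

        -- If a i ≤ 0 then the facet lies in the face x i = 0, hence equals it;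
        -- that face contains the origin and every other unit vector.
        a≰0 : ∀ i → ¬ a i ≤ 0#
        a≰0 i ai≤0 with other i
        ... | j , j≢i = a≉0 j (≈-trans (≈-sym (weight-⁅⁆ a j))
                (≈-trans (exhausts ⁅ j ⁆ (⁅⁆-stable j) λ i∈ → j≢i (≡.sym (x∈⁅y⁆⇒x≡y j i∈)))
                (≈-trans (≈-sym (exhausts Subset.⊥ ⊥-stable ∉⊥)) (weight-⊥ a))))
          where
          d : Vector Carrier n
          d k = - inc ⁅ i ⁆ k
          d≈-1 : d i ≈ - 1#
          d≈-1 = -‿cong (≈-reflexive (inc-∈ (x∈⁅x⁆ i)))
          d≈0 : ∀ {k} → k ≢ i → d k ≈ 0#
          d≈0 k≢i = ≈-trans (-‿cong (≈-reflexive (inc-∉ (k≢i ∘ x∈⁅y⁆⇒x≡y i)))) -0#≈0#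
          in-weight : ∀ {S} → i ∈ S → weight d S ≈ - 1#
          in-weight i∈S = ≈-trans (weight-only d i∈S λ _ → d≈0) d≈-1
          out-weight : ∀ {S} → i ∉ S → weight d S ≈ 0#
          out-weight i∉S = weight-≈0 d λ k∈S → d≈0 λ { refl → i∉S k∈S }
          -1≤0 : - 1# ≤ 0#
          -1≤0 = 0≤-⇒≤ (≤-trans 0≤1 (≤-reflexive (≈-sym (≈-trans (+-identityˡ _) (-‿involutive 1#)))))
          d-valid : ∀ S → Stable G S → weight d S ≤ 0#
          d-valid S _ with i ∈? S
          ... | yes i∈S = ≤-trans (≤-reflexive (in-weight i∈S)) -1≤0
          ... | no i∉S  = ≤-reflexive (out-weight i∉S)
          tight : ∀ S → Tight S → weight d S ≈ 0#
          tight S (S-stable , S≈b) with i ∈? S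
          ... | no i∉S  = out-weight i∉S
          -- Deleting `i` leaves a stable set of weight `b - a i`, which is at most `b`; hence `a i`
          -- is also nonnegative, and so zero.
          ... | yes i∈S = ⊥-elim (a≉0 i (antisym ai≤0 (+-cancelʳ-≤ (weight a (S ∖ i))
                  (≤-trans (≤-reflexive (+-identityˡ _)) (≤-trans (valid (∖-stable {S} {i} S-stable))
                  (≤-reflexive (≈-trans (≈-sym S≈b) (≈-trans (weight-∖ a i∈S) (+-comm _ _)))))))))
          exhausts : ∀ S → Stable G S → i ∉ S → weight a S ≈ b
          exhausts S S-stable i∉S = facet-exhausts d-valid tight
            (⁅ i ⁆ , ⁅⁆-stable i , λ w≈0 → 0≉1 (≈-sym (begin
              1#     ≈⟨ -‿involutive 1# ⟨
              - - 1# ≈⟨ -‿cong (in-weight (x∈⁅x⁆ i)) ⟨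
              - weight d ⁅ i ⁆ ≈⟨ -‿cong w≈0 ⟩
              - 0#   ≈⟨ -0#≈0# ⟩
              0#     ∎)))
            S S-stable (out-weight i∉S)
            where open import Relation.Binary.Reasoning.Setoid setoid

        -- Otherwise `y` could be added, raising the weight from `b` to `b + a y` with `a y`
        -- positive.
        tight-maximal : ∀ {S y} → Tight S → y ∉ S → ∃[ r ] r ∈ S × r ∼ y
        tight-maximal {S} {y} (S-stable , S≈b) y∉S with Finₚ.any? (λ r → (r ∈? S) ×-dec (r ∼? y))
        ... | yes p = p
        ... | no ¬p = ⊥-elim (a≰0 y (x+y≤x⇒y≤0 (begin
            b + a y                      ≈⟨ +-cong S≈b (weight-⁅⁆ a y) ⟨
            weight a S + weight a ⁅ y ⁆  ≈⟨ weight-∪ a (λ i∈S i∈ → y∉S (≡.subst (_∈ S) (x∈⁅y⁆⇒x≡y y i∈) i∈S)) ⟨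
            weight a (S ∪ ⁅ y ⁆)         ≤⟨ valid (insert-stable S-stable (⁅⁆-stable y)
                                              λ { i∈S j∈ i∼j → ¬p (_ , i∈S , ≡.subst (_ ∼_) (x∈⁅y⁆⇒x≡y y j∈) i∼j) }) ⟩
            b                            ∎)))
          where open import Relation.Binary.Reasoning.PartialOrder poset

        -- Since `x` is the only member of `S` with neighbours in `T`, the set obtained from `S` by
        -- trading `x` for `T` is stable, and its weight cannot exceed that of the tight set `S`.
        exchange : ∀ {S T x} → Tight S → x ∈ S → Stable G T → (∀ {y} → y ∈ T → y ∉ S) →
                   (∀ {y r} → y ∈ T → r ∈ S → r ∼ y → r ≡ x) → weight a T ≤ a x
        exchange {S} {T} {x} (S-stable , S≈b) x∈S T-stable T∉S nbr = +-cancelʳ-≤ (weight a (S ∖ x)) (begin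
          weight a T + weight a (S ∖ x)  ≈⟨ +-comm _ _ ⟩
          weight a (S ∖ x) + weight a T  ≈⟨ weight-∪ a (λ i∈ i∈T → T∉S i∈T (proj₁ (∖⁻ {S = S} {x} i∈))) ⟨
          weight a ((S ∖ x) ∪ T)         ≤⟨ valid (insert-stable (∖-stable {S} {x} S-stable) T-stable
                                              λ i∈ j∈T i∼j → proj₂ (∖⁻ {S = S} {x} i∈)
                                                (nbr j∈T (proj₁ (∖⁻ {S = S} {x} i∈)) i∼j)) ⟩
          b                              ≈⟨ S≈b ⟨
          weight a S                     ≈⟨ weight-∖ a x∈S ⟩
          weight a (S ∖ x) + a x         ≈⟨ +-comm _ _ ⟩
          a x + weight a (S ∖ x)         ∎)
          where open import Relation.Binary.Reasoning.PartialOrder poset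

        exchange₁ : ∀ {S x y} → Tight S → x ∈ S → y ∉ S → (∀ {r} → r ∈ S → r ∼ y → r ≡ x) → a y ≤ a x
        exchange₁ {y = y} tight x∈S y∉S nbr = ≤-trans (≤-reflexive (≈-sym (weight-⁅⁆ a y)))
          (exchange tight x∈S (⁅⁆-stable y) (λ i∈ → ≡.subst (_∉ _) (≡.sym (x∈⁅y⁆⇒x≡y y i∈)) y∉S)
            λ i∈ r∈S r∼i → nbr r∈S (≡.subst (_ ∼_) (x∈⁅y⁆⇒x≡y y i∈) r∼i))

        exchange₂ : ∀ {S x y z} → Tight S → x ∈ S → y ∉ S → z ∉ S → y ≢ z → ¬ y ∼ z →
                    (∀ {r} → r ∈ S → r ∼ y → r ≡ x) → (∀ {r} → r ∈ S → r ∼ z → r ≡ x) → a y + a z ≤ a x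
        exchange₂ {S} {x} {y} {z} tight x∈S y∉S z∉S y≢z y≁z nbr-y nbr-z =
          ≤-trans (≤-reflexive (≈-sym (≈-trans
            (weight-∪ a λ i∈ i∈′ → y≢z (≡.trans (≡.sym (x∈⁅y⁆⇒x≡y y i∈)) (x∈⁅y⁆⇒x≡y z i∈′)))
            (+-cong (weight-⁅⁆ a y) (weight-⁅⁆ a z)))))
          (exchange tight x∈S
            (insert-stable (⁅⁆-stable y) (⁅⁆-stable z) λ { i∈ j∈ i∼j →
               y≁z (≡.subst₂ _∼_ (x∈⁅y⁆⇒x≡y y i∈) (x∈⁅y⁆⇒x≡y z j∈) i∼j) })
            (λ i∈ → [ (λ p → ≡.subst (_∉ S) (≡.sym (x∈⁅y⁆⇒x≡y y p)) y∉S)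
                    , (λ p → ≡.subst (_∉ S) (≡.sym (x∈⁅y⁆⇒x≡y z p)) z∉S) ]′ (x∈p∪q⁻ ⁅ y ⁆ ⁅ z ⁆ i∈))
            (λ i∈ r∈S r∼i → [ (λ p → nbr-y r∈S (≡.subst (_ ∼_) (x∈⁅y⁆⇒x≡y y p) r∼i))
                            , (λ p → nbr-z r∈S (≡.subst (_ ∼_) (x∈⁅y⁆⇒x≡y z p) r∼i)) ]′ (x∈p∪q⁻ ⁅ y ⁆ ⁅ z ⁆ i∈)))

        module _ {Hub Rim : Pred (Fin n) 0ℓ} (hub? : Decidable Hub) (rim? : Decidable Rim)
                 (hub-clique : ∀ {i j} → Hub i → Hub j → i ≢ j → i ∼ j)
                 (hub-rim : ∀ {i j} → Hub i → Rim j → i ∼ j)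
                 (rim-α≤2 : ∀ {i j k} → Rim i → Rim j → Rim k → i ≢ j → i ≢ k → j ≢ k →
                            ¬ i ∼ j → ¬ i ∼ k → ¬ j ∼ k → ⊥)
                 where

          private
            2# : Carrier
            2# = 1# + 1#
            d : Vector Carrier n
            d i = if does (hub? i) then 2# else if does (rim? i) then 1# else 0#
            d-hub : ∀ {i} → Hub i → d i ≈ 2#
            d-hub {i} h rewrite dec-true (hub? i) h = ≈-refl
            d-rim : ∀ {i} → ¬ Hub i → Rim i → d i ≈ 1#
            d-rim {i} ¬h r rewrite dec-false (hub? i) ¬h | dec-true (rim? i) r = ≈-refl
            d-else : ∀ {i} → ¬ Hub i → ¬ Rim i → d i ≈ 0#
            d-else {i} ¬h ¬r rewrite dec-false (hub? i) ¬h | dec-false (rim? i) ¬r = ≈-refl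

            AtMostOneRim : Subset n → Set
            AtMostOneRim S = (∀ {i} → i ∈ S → ¬ Hub i) × (∀ {i j} → i ∈ S → j ∈ S → Rim i → Rim j → i ≡ j)

            1≤2 : 1# ≤ 2#
            1≤2 = ≤-trans (≤-reflexive (≈-sym (+-identityˡ 1#))) (+-monoˡ-≤ 1# 0≤1)

            -- A hub in `S` excludes every other vertex of the support of `d`, and `rim-α≤2` allows
            -- two rim vertices at most; so the value 2 can be missed only in the second
            -- alternative.
            weigh : ∀ S → Stable G S → weight d S ≈ 2# ⊎ (AtMostOneRim S × weight d S ≤ 2#)
            weigh S S-stable with Finₚ.any? (λ i → (i ∈? S) ×-dec hub? i)
            ... | yes (w , w∈S , w-hub) = inj₁ (≈-trans (weight-only d w∈S λ {i} i∈S i≢w → d-else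
                    (λ h → S-stable i w i∈S w∈S (hub-clique h w-hub i≢w))
                    (λ r → S-stable w i w∈S i∈S (hub-rim w-hub r))) (d-hub w-hub))
            ... | no no-hub with Finₚ.any? (λ i → (i ∈? S) ×-dec rim? i)
            ... | no no-rim = inj₂ (((λ i∈S h → no-hub (_ , i∈S , h)) , λ i∈S _ r _ → ⊥-elim (no-rim (_ , i∈S , r)))
                  , ≤-trans (≤-reflexive (weight-≈0 d λ i∈S →
                    d-else (λ h → no-hub (_ , i∈S , h)) (λ r → no-rim (_ , i∈S , r))))
                      (≤-trans 0≤1 1≤2))
            ... | yes (x , x∈S , x-rim) with Finₚ.any? (λ i → (i ∈? S) ×-dec (rim? i ×-dec ¬? (i Finₚ.≟ x)))
            ... | no no-second = inj₂ (((λ i∈S h → no-hub (_ , i∈S , h)) , λ i∈S j∈S r r′ →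
              ≡.trans (same i∈S r) (≡.sym (same j∈S r′)))
                  , ≤-trans (≤-reflexive (≈-trans (weight-only d x∈S λ i∈S i≢x →
                    d-else (λ h → no-hub (_ , i∈S , h)) (i≢x ∘ same i∈S))
                      (d-rim (λ h → no-hub (_ , x∈S , h)) x-rim))) 1≤2)
              where
              same : ∀ {i} → i ∈ S → Rim i → i ≡ x
              same {i} i∈S r with i Finₚ.≟ x
              ... | yes i≡x = i≡x
              ... | no i≢x  = ⊥-elim (no-second (i , i∈S , r , i≢x))
            ... | yes (y , y∈S , y-rim , y≢x) = inj₁ (≈-trans (weight-∖ d x∈S) (+-cong
                    (≈-trans (weight-only d (∖⁺ y∈S y≢x) rest) (d-rim (λ h → no-hub (_ , y∈S , h)) y-rim))
                    (d-rim (λ h → no-hub (_ , x∈S , h)) x-rim)))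
              where
              rest : ∀ {i} → i ∈ S ∖ x → i ≢ y → d i ≈ 0#
              rest {i} i∈ i≢y with ∖⁻ {S = S} {x} i∈
              ... | i∈S , i≢x = d-else (λ h → no-hub (_ , i∈S , h)) λ r → rim-α≤2 r y-rim x-rim i≢y i≢x y≢x
                      (S-stable i y i∈S y∈S) (S-stable i x i∈S x∈S) (S-stable y x y∈S x∈S)

          -- If no such S existed, the facet would be the face 2 x(Hub) + x(Rim) = 2 and
          -- {v} would be tight, although {v , t} is stable.
          wheel-missed : ∀ {v t} → Hub v → v ≢ t → ¬ v ∼ t →
            (∀ {S} → Tight S → (∀ {i} → i ∈ S → ¬ Hub i) → (∀ {i j} → i ∈ S → j ∈ S → Rim i → Rim j → i ≡ j) → ⊥) → ⊥
          wheel-missed {v} {t} v-hub v≢t v≁t none = avoid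
            (tight-maximal (⁅⁆-stable v , v-tight) λ t∈ → v≢t (≡.sym (x∈⁅y⁆⇒x≡y v t∈)))
            where
            v-tight : weight a ⁅ v ⁆ ≈ b
            v-tight = facet-exhausts {d} {2#}
              (λ S S-stable → [ ≤-reflexive , proj₂ ]′ (weigh S S-stable))
              (λ S tight → [ (λ p → p) , (λ { ((no-hub , one-rim) , _) → ⊥-elim (none tight no-hub one-rim) }) ]′
                (weigh S (proj₁ tight)))
              -- The empty set has value 0, which keeps the face `d · x = 2` proper.
              (Subset.⊥ , ⊥-stable , λ 0≈2 → 0≉1
                (antisym 0≤1 (≤-trans 1≤2 (≤-reflexive (≈-trans (≈-sym 0≈2) (weight-⊥ d))))))
              ⁅ v ⁆ (⁅⁆-stable v) (≈-trans (weight-⁅⁆ d v) (d-hub v-hub))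
            avoid : ¬ (∃[ r ] r ∈ ⁅ v ⁆ × r ∼ t)
            avoid (r , r∈ , r∼t) = v≁t (≡.subst (_∼ t) (x∈⁅y⁆⇒x≡y v r∈) r∼t)

        -- A clique is a wheel with empty rim: the inequality becomes 2 x(K) ≤ 2 and the condition
        -- on rim vertices is vacuous.
        clique-missed : ∀ {K : Pred (Fin n) 0ℓ} (K? : Decidable K) → (∀ {i j} → K i → K j → i ≢ j → i ∼ j) →
          ∀ {k u} → K k → k ≢ u → ¬ k ∼ u → (∀ {S} → Tight S → (∀ {i} → i ∈ S → ¬ K i) → ⊥) → ⊥
        clique-missed K? clique k∈K k≢u k≁u none =
          wheel-missed {Rim = λ _ → ⊥} K? (λ _ → no λ ()) clique (λ _ ()) (λ ()) k∈K k≢u k≁u λ tight missed _ →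
            none tight missed

-- Integral certificates and their transfer from an induced subgraph.

-- The first coordinate of z is the homogenising one.
Feasible : ∀ {m} → Graph m → (Fin (ℕ.suc m) → ℤ) → Set
Feasible H z = (∀ p → + 0 ℤ.≤ z p × z p ℤ.≤ z zero) ×
               (∀ i j → i ∼ j → z (suc i) ℤ.+ z (suc j) ℤ.≤ z zero)
  where open Graph H

-- Y is an integral multiple of a matrix in M₊ (ESTAB H), with a multiple
-- written as a sum of weighted squares, and its column zero violates x(V) ≤ α.
record Certificate {m} (H : Graph m) : Set where
  field
    Y          : Fin (ℕ.suc m) → Fin (ℕ.suc m) → ℤ
    Y-sym      : ∀ p q → Y p q ≡ Y q p
    Y-diag     : ∀ p → Y p zero ≡ Y p p
    scale>0    : + 0 ℤ.< Y zero zero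
    feasible₀  : Feasible H λ p → Y p zero
    feasible   : ∀ i → Feasible H λ p → Y p (suc i)
    feasible′  : ∀ i → Feasible H λ p → Y p zero ℤ.- Y p (suc i)
    rank       : ℕ
    multiple   : ℤ
    multiple>0 : + 0 ℤ.< multiple
    w          : Fin rank → ℤ
    w≥0        : ∀ r → + 0 ℤ.≤ w r
    L          : Fin rank → Fin (ℕ.suc m) → ℤ
    gram       : ∀ p q → multiple ℤ.* Y p q ≡ ℤΣ.sum λ r → w r ℤ.* (L r p ℤ.* L r q)
    α          : ℕ
    stable≤α   : ∀ S → Stable H S → ∣ S ∣ ℕ.≤ α
    violated   : Y zero zero ℤ.* + α ℤ.< ℤΣ.sum λ i → Y (suc i) zero

module LovászSchrijver (ℝ : CompleteOrderedField) where
  open OrderedField ℝ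
  open Polyhedra ℝ

  -- Division by the homogenising coordinate works unless it is zero; then the bounds force every
  -- coordinate to zero, and the origin serves as the point of `ESTAB`.
  cone-ESTAB : ∀ {n} (G : Graph n) (x : Vector Carrier (ℕ.suc n)) →
    (∀ k → 0# ≤ x k × x k ≤ x zero) → (∀ i j → Graph._∼_ G i j → x (suc i) + x (suc j) ≤ x zero) →
    Cone ℝ (ESTAB ℝ G) x
  cone-ESTAB G x bounds edges with x zero ≟ 0#
  ... | yes x₀≈0 = const 0# , ((λ _ → ≤-refl , 0≤1) , λ _ _ _ → ≤-trans (≤-reflexive (+-identityˡ 0#)) 0≤1) ,
          λ i → ≈-trans (antisym (≤-trans (proj₂ (bounds (suc i))) (≤-reflexive x₀≈0)) (proj₁ (bounds (suc i))))
            (≈-sym (zeroʳ _))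
  ... | no x₀≉0 with inverse (x zero) x₀≉0
  ... | x₀⁻¹ , inv = (λ i → x₀⁻¹ * x (suc i)) ,
          ( (λ i → *-nonNegative 0≤x₀⁻¹ (proj₁ (bounds (suc i))) , below (proj₂ (bounds (suc i))))
          , (λ i j i∼j → ≤-trans (≤-reflexive (≈-sym (distribˡ _ _ _))) (below (edges i j i∼j)))) ,
          λ i → ≈-sym (≈-trans (≈-sym (*-assoc _ _ _)) (≈-trans (*-congʳ inv) (*-identityˡ _)))
    where
    0≤x₀⁻¹ : 0# ≤ x₀⁻¹
    0≤x₀⁻¹ = inverse-nonNegative (proj₁ (bounds zero)) inv
    below : ∀ {y} → y ≤ x zero → x₀⁻¹ * y ≤ 1#
    below y≤ = ≤-trans (*-monoʳ-≤ 0≤x₀⁻¹ y≤) (≤-reflexive (≈-trans (*-comm _ _) inv))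

  Cone-resp-≈ : ∀ {n} {K : Pred (Vector Carrier n) _} {x y : Vector Carrier (ℕ.suc n)} →
                (∀ k → y k ≈ x k) → Cone ℝ K x → Cone ℝ K y
  Cone-resp-≈ y≈x (z , z∈K , x≈) = z , z∈K , λ i → ≈-trans (y≈x (suc i)) (≈-trans (x≈ i) (*-congʳ (≈-sym (y≈x zero))))

  sum-lookup : ∀ {m} (S : Subset m) → (sum λ i → 1# * (if lookup S i then 1# else 0#)) ≈ ι (+ ∣ S ∣)
  sum-lookup []          = ≈-refl
  sum-lookup (true ∷ S)  = +-cong (*-identityˡ 1#) (sum-lookup S)
  sum-lookup (false ∷ S) = ≈-trans (+-cong (zeroʳ _) (sum-lookup S)) (+-identityˡ _)

  module _ {m n} {H : Graph m} {G : Graph n} (emb : H InducedIn G) where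
    open _InducedIn_ emb
    private
      module H = Graph H
      module G = Graph G

    preimage : Fin n → Maybe (Fin m)
    preimage i with Finₚ.any? (λ p → f p Finₚ.≟ i)
    ... | yes (p , _) = just p
    ... | no _        = nothing

    preimage-just : ∀ {i p} → preimage i ≡ just p → f p ≡ i
    preimage-just {i} eq with Finₚ.any? (λ p → f p Finₚ.≟ i)
    preimage-just refl | yes (_ , fp≡i) = fp≡i

    preimage-f : ∀ p → preimage (f p) ≡ just p
    preimage-f p with Finₚ.any? (λ q → f q Finₚ.≟ f p)
    ... | yes (q , fq≡fp) = ≡.cong just (injective fq≡fp)
    ... | no ¬p           = ⊥-elim (¬p (p , refl))

    -- Used contrapositively: a point of G is outside `STAB` as soon as its restriction to the copy
    -- of H is. Stability survives restriction because the embedding preserves edges.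
    restrict-STAB : ∀ {x} → STAB ℝ G x → STAB ℝ H (x ∘ f)
    restrict-STAB (k , c , p , 0≤c , ∑c , p∈ , x≈) = k , c , (λ j → p j ∘ f) , 0≤c , ∑c , restrict ∘ p∈ , x≈ ∘ f
      where
      restrict : ∀ {y} → IncidenceVector G y → IncidenceVector H (y ∘ f)
      restrict {y} (S , S-stable , y≈) = S′ , stable′ , λ i → ≈-trans (y≈ (f i))
        (≈-reflexive (≡.cong (if_then 1# else 0#) (≡.sym (lookup∘tabulate (lookup S ∘ f) i))))
        where
        S′ : Subset m
        S′ = tabulate (lookup S ∘ f)
        pull : ∀ {i} → i ∈ S′ → f i ∈ S
        pull {i} i∈ = lookup⇒[]= (f i) S (≡.trans (≡.sym (lookup∘tabulate (lookup S ∘ f) i)) ([]=⇒lookup i∈))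
        stable′ : Stable H S′
        stable′ i j i∈ j∈ i∼j = S-stable (f i) (f j) (pull i∈) (pull j∈) (preserves i∼j)

    -- Certified vectors and matrices of H are padded with zeros outside the copy of H in G.
    index : Fin (ℕ.suc n) → Maybe (Fin (ℕ.suc m))
    index zero    = just zero
    index (suc i) = Maybe.map suc (preimage i)

    extend : (Fin (ℕ.suc m) → ℤ) → Maybe (Fin (ℕ.suc m)) → ℤ
    extend z (just p) = z p
    extend z nothing  = + 0

    extend-bounds : ∀ {z} → Feasible H z → ∀ p → + 0 ℤ.≤ extend z p × extend z p ℤ.≤ z zero
    extend-bounds (bounds , _) (just p) = bounds p
    extend-bounds (bounds , _) nothing  = ℤₚ.≤-refl , proj₁ (bounds zero)

    -- Here the subgraph has to be induced: an edge of G within the copy must come from H by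
    -- `reflects`. With an end outside the copy, the bound by `z zero` suffices.
    extend-edges : ∀ {z} → Feasible H z → ∀ i j → i G.∼ j →
                   extend z (index (suc i)) ℤ.+ extend z (index (suc j)) ℤ.≤ z zero
    extend-edges (bounds , edges) i j i∼j with preimage i in eqᵢ | preimage j in eqⱼ
    ... | just p  | just q  = edges p q
      (reflects (≡.subst₂ G._∼_ (≡.sym (preimage-just eqᵢ)) (≡.sym (preimage-just eqⱼ)) i∼j))
    ... | just p  | nothing = ℤₚ.≤-trans (ℤₚ.≤-reflexive (ℤₚ.+-identityʳ _)) (proj₂ (bounds (suc p)))
    ... | nothing | just q  = ℤₚ.≤-trans (ℤₚ.≤-reflexive (ℤₚ.+-identityˡ _)) (proj₂ (bounds (suc q)))
    ... | nothing | nothing = proj₁ (bounds zero)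

    extend-cone : ∀ {s z} → 0# ≤ s → Feasible H z → Cone ℝ (ESTAB ℝ G) λ k → s * ι (extend z (index k))
    extend-cone {s} {z} 0≤s feas = cone-ESTAB G _
      (λ k → *-nonNegative 0≤s (ι-nonNegative (proj₁ (extend-bounds feas (index k))))
           , *-monoʳ-≤ 0≤s (ι-mono-≤ (proj₂ (extend-bounds feas (index k)))))
      (λ i j i∼j → ≤-trans (≤-reflexive (≈-trans (≈-sym (distribˡ s _ _))
          (*-congˡ (≈-sym (ι-+ (extend z (index (suc i))) (extend z (index (suc j))))))))
        (*-monoʳ-≤ 0≤s (ι-mono-≤ (extend-edges feas i j i∼j))))

    module _ (certificate : Certificate H) (s : Carrier) (0≤s : 0# ≤ s)
             (scale*s≈1 : ι (Certificate.Y certificate zero zero) * s ≈ 1#) where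
      open Certificate certificate

      private
        column : Maybe (Fin (ℕ.suc m)) → Fin (ℕ.suc m) → ℤ
        column (just q) p = Y p q
        column nothing  p = + 0

        entry : (p q : Maybe (Fin (ℕ.suc m))) → ℤ
        entry p q = extend (column q) p

        Z : Matrix ℝ (ℕ.suc n)
        Z k l = s * ι (entry (index k) (index l))

        feasible-column : ∀ p → Feasible H (column (Maybe.map suc p))
        feasible-column (just p) = feasible p
        feasible-column nothing  = (λ _ → ℤₚ.≤-refl , ℤₚ.≤-refl) , λ _ _ _ → ℤₚ.≤-refl

        scaled-minus : ∀ x y → s * x - s * y ≈ s * (x - y)
        scaled-minus = solve 3 (λ s x y → s :* x :- s :* y := s :* (x :- y)) ≈-refl s

        complement : ∀ i → Cone ℝ (ESTAB ℝ G) λ k → Z k zero - Z k (suc i)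
        complement i = helper (preimage i)
          where
          entry-minus : ∀ q p → entry p (just zero) ℤ.- entry p (just q) ≡ extend (λ r → Y r zero ℤ.- Y r q) p
          entry-minus q (just p) = refl
          entry-minus q nothing  = refl
          entry-nothing : ∀ p → entry p nothing ≡ + 0
          entry-nothing (just p) = refl
          entry-nothing nothing  = refl
          helper : ∀ p → Cone ℝ (ESTAB ℝ G) λ k → Z k zero - s * ι (entry (index k) (Maybe.map suc p))
          helper (just p) = Cone-resp-≈ {x =
            λ k → s * ι (extend (λ r → Y r zero ℤ.- Y r (suc p)) (index k))} (λ k → ≈-trans (scaled-minus _ _)
              (*-congˡ (≈-trans (≈-sym (ι-minus (entry (index k) (just zero)) (entry (index k) (just (suc p)))))
                (≈-reflexive (≡.cong ι (entry-minus (suc p) (index k)))))))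
            (extend-cone 0≤s (feasible′ p))
          -- Outside the copy of H the column of `Z` is zero, so its complement is column zero,
          -- which `feasible₀` covers.
          helper nothing = Cone-resp-≈ {x = λ k → Z k zero} (λ k → ≈-trans
              (+-congˡ (≈-trans (-‿cong (≈-trans (*-congˡ (≈-reflexive (≡.cong ι (entry-nothing (index k)))))
                (zeroʳ s))) -0#≈0#))
              (+-identityʳ _))
            (extend-cone 0≤s feasible₀)

        entry-sym : ∀ p q → entry p q ≡ entry q p
        entry-sym (just p) (just q) = Y-sym p q
        entry-sym (just p) nothing  = refl
        entry-sym nothing  (just q) = refl
        entry-sym nothing  nothing  = refl

        entry-diag : ∀ p → entry p (just zero) ≡ entry p p
        entry-diag (just p) = Y-diag p
        entry-diag nothing  = refl

        entry-gram : ∀ p q → multiple ℤ.* entry p q ≡ ℤΣ.sum λ r → w r ℤ.* (extend (L r) p ℤ.* extend (L r) q)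
        entry-gram = λ where
            (just p) (just q) → gram p q
            (just p) nothing  → vanish λ r → ℤₚ.*-zeroʳ (L r p)
            nothing  (just q) → vanish λ r → ℤₚ.*-zeroˡ (L r q)
            nothing  nothing  → vanish λ _ → refl
          where
          vanish : ∀ {x : Fin rank → ℤ} → (∀ r → x r ≡ + 0) → multiple ℤ.* + 0 ≡ ℤΣ.sum λ r → w r ℤ.* x r
          vanish x≡0 = ≡.trans (ℤₚ.*-zeroʳ multiple) (≡.sym (≡.trans
            (ℤΣ.sum-cong-≗ λ r → ≡.trans (≡.cong (w r ℤ.*_) (x≡0 r)) (ℤₚ.*-zeroʳ (w r)))
              (ℤΣ.sum-replicate-zero rank)))

        R : Fin rank → Vector Carrier (ℕ.suc n)
        R r k = ι (extend (L r) (index k))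

        Z-gram : ∀ k l → ι multiple * Z k l ≈ s * sum λ r → ι (w r) * (R r k * R r l)
        Z-gram k l = ≈-trans (solve 3 (λ d s y → d :* (s :* y) := s :* (d :* y)) ≈-refl (ι multiple) s
          (ι (entry (index k) (index l))))
          (*-congˡ (≈-trans (≈-sym (ι-* multiple (entry (index k) (index l))))
            (≈-trans (≈-reflexive (≡.cong ι (entry-gram (index k) (index l))))
            (≈-trans (ι-sum {rank} λ r → w r ℤ.* (extend (L r) (index k) ℤ.* extend (L r) (index l)))
              (sum-cong-≋ {rank} λ r → ≈-trans (ι-* (w r) _)
                (*-congˡ (ι-* (extend (L r) (index k)) (extend (L r) (index l)))))))))

        -- After interchanging sums, the double sum belonging to each `r` factors into two equal
        -- sums and is a square. The factor `multiple`, which clears denominators, is cancelled only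
        -- once nonnegativity is at hand.
        Z-form : ∀ (v : Vector Carrier (ℕ.suc n)) → ι multiple * (sum λ k → sum λ l → v k * Z k l * v l) ≈
                       s * sum λ r → ι (w r) * ((sum λ k → R r k * v k) * (sum λ k → R r k * v k))
        Z-form v = begin
          ι multiple * (sum λ k → sum λ l → v k * Z k l * v l)
            ≈⟨ pull _ (λ k l → v k * Z k l * v l) ⟩
          (sum λ k → sum λ l → ι multiple * (v k * Z k l * v l))
            ≈⟨ cong₂ (λ k l → begin
                 ι multiple * (v k * Z k l * v l)
                   ≈⟨ solve 4 (λ d x z y → d :* (x :* z :* y) := (d :* z) :* (x :* y)) ≈-refl (ι multiple) (v k)
                     (Z k l) (v l) ⟩
                 (ι multiple * Z k l) * (v k * v l)
                   ≈⟨ *-congʳ (Z-gram k l) ⟩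
                 (s * sum λ r → ι (w r) * (R r k * R r l)) * (v k * v l)
                   ≈⟨ *-assoc s _ _ ⟩
                 s * ((sum λ r → ι (w r) * (R r k * R r l)) * (v k * v l))
                   ≈⟨ *-congˡ (≈-trans (*-distribʳ-sum {rank} (v k * v l) _) (sum-cong-≋ {rank} λ r →
                        solve 5 (λ w a b x y → w :* (a :* b) :* (x :* y) := w :* ((a :* x) :* (b :* y))) ≈-refl
                          (ι (w r)) (R r k) (R r l) (v k) (v l))) ⟩
                 s * (sum λ r → ι (w r) * (u r k * u r l)) ∎) ⟩
          (sum λ k → sum λ l → s * sum λ r → ι (w r) * (u r k * u r l))
            ≈⟨ pull s (λ k l → sum λ r → ι (w r) * (u r k * u r l)) ⟨
          s * (sum λ k → sum λ l → sum λ r → ι (w r) * (u r k * u r l))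
            ≈⟨ *-congˡ (≈-trans (sum-cong-≋ {ℕ.suc n} λ k →
              ∑-comm {ℕ.suc n} {rank} (λ l r → ι (w r) * (u r k * u r l)))
                 (∑-comm {ℕ.suc n} {rank} (λ k r → sum λ l → ι (w r) * (u r k * u r l)))) ⟩
          s * (sum λ r → sum λ k → sum λ l → ι (w r) * (u r k * u r l))
            ≈⟨ *-congˡ (sum-cong-≋ {rank} λ r → ≈-trans (≈-sym (pull (ι (w r)) (λ k l → u r k * u r l)))
                 (*-congˡ (≈-trans (sum-cong-≋ {ℕ.suc n} λ k → ≈-sym (*-distribˡ-sum {ℕ.suc n} (u r k) (u r)))
                   (≈-sym (*-distribʳ-sum {ℕ.suc n} (sum (u r)) (u r)))))) ⟩
          s * (sum λ r → ι (w r) * (sum (u r) * sum (u r))) ∎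
          where
          open import Relation.Binary.Reasoning.Setoid setoid
          u : Fin rank → Vector Carrier (ℕ.suc n)
          u r k = R r k * v k
          cong₂ : {x y : Matrix ℝ (ℕ.suc n)} → (∀ k l → x k l ≈ y k l) →
            (sum λ k → sum λ l → x k l) ≈ (sum λ k → sum λ l → y k l)
          cong₂ p = sum-cong-≋ {ℕ.suc n} λ k → sum-cong-≋ {ℕ.suc n} (p k)
          pull : ∀ c (x : Matrix ℝ (ℕ.suc n)) → c * (sum λ k → sum λ l → x k l) ≈ (sum λ k → sum λ l → c * x k l)
          pull c x = ≈-trans (*-distribˡ-sum {ℕ.suc n} c (λ k → sum (x k))) (sum-cong-≋ {ℕ.suc n} λ k →
            *-distribˡ-sum {ℕ.suc n} c (x k))

        Z-psd : PositiveSemidefinite ℝ Z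
        Z-psd = (λ k l → *-congˡ (≈-reflexive (≡.cong ι (entry-sym (index k) (index l))))) , λ v →
          nonNegative (≤-trans (*-nonNegative 0≤s (sum-nonNegative {rank} λ r →
            *-nonNegative (ι-nonNegative (w≥0 r)) (0≤x² _))) (≤-reflexive (≈-sym (Z-form v))))
          where
          ι-multiple≉0 : ¬ ι multiple ≈ 0#
          ι-multiple≉0 p = ι-mono-< multiple>0 (≤-reflexive p)
          nonNegative : ∀ {x} → 0# ≤ ι multiple * x → 0# ≤ x
          nonNegative {x} 0≤ with inverse _ ι-multiple≉0
          ... | t , inv = ≤-trans (*-nonNegative (inverse-nonNegative (ι-nonNegative (ℤₚ.<⇒≤ multiple>0)) inv) 0≤)
            (≤-reflexive (≈-trans (≈-sym (*-assoc _ _ _))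
              (≈-trans (*-congʳ (≈-trans (*-comm _ _) inv)) (*-identityˡ x))))

        point : Vector Carrier n
        point i = Z (suc i) zero

        scaled≈1 : s * ι (Y zero zero) ≈ 1#
        scaled≈1 = ≈-trans (*-comm _ _) scale*s≈1

        point∈LS₊ : LS₊ ℝ (ESTAB ℝ G) point
        point∈LS₊ =
          (λ i → *-nonNegative 0≤s (ι-nonNegative (proj₁ (extend-bounds feasible₀ (index (suc i)))))
               , ≤-trans (*-monoʳ-≤ 0≤s (ι-mono-≤ (proj₂ (extend-bounds feasible₀ (index (suc i))))))
                 (≤-reflexive scaled≈1)) ,
          Z , record { positiveSemidefinite = Z-psd ; diagonal =
            λ k → *-congˡ (≈-reflexive (≡.cong ι (entry-diag (index k))))
                     ; column = λ i → extend-cone 0≤s (feasible-column (preimage i)) ; columnComplement =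
                       complement } ,
          λ { zero → ≈-sym scaled≈1 ; (suc i) → ≈-refl }

        -- On the copy of H a point of `STAB` would satisfy x(V) ≤ α; scaled by `Y zero zero`, this
        -- contradicts the integer inequality `violated`.
        point∉STAB : ¬ STAB ℝ G point
        point∉STAB point∈ = ι-mono-< violated (begin
          ι (ℤΣ.sum λ p → Y (suc p) zero)            ≈⟨ ι-sum {m} _ ⟩
          (sum λ p → ι (Y (suc p) zero))             ≈⟨ sum-cong-≋ {m} unscale ⟨
          (sum λ p → ι (Y zero zero) * (1# * point (f p))) ≈⟨ *-distribˡ-sum {m} _ (λ p → 1# * point (f p)) ⟨
          ι (Y zero zero) * (const 1# ∙ (point ∘ f)) ≤⟨ *-monoʳ-≤ (ι-nonNegative (ℤₚ.<⇒≤ scale>0)) bound ⟩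
          ι (Y zero zero) * ι (+ α)                  ≈⟨ ι-* (Y zero zero) (+ α) ⟨
          ι (Y zero zero ℤ.* + α)                    ∎)
          where
          open import Relation.Binary.Reasoning.PartialOrder poset
          unscale : ∀ p → ι (Y zero zero) * (1# * point (f p)) ≈ ι (Y (suc p) zero)
          unscale p = ≈-trans (*-congˡ (*-congˡ
            (*-congˡ (≈-reflexive (≡.cong (λ q → ι (entry (Maybe.map suc q) (just zero))) (preimage-f p))))))
            (≈-trans (≈-trans (*-congˡ (*-identityˡ _)) (≈-sym (*-assoc _ _ _)))
            (≈-trans (*-congʳ scale*s≈1) (*-identityˡ _)))
          bound : const 1# ∙ (point ∘ f) ≤ ι (+ α)
          bound = hull-≤ (const 1#) (onIncidence H (const 1#) (≤-trans ∘ ≤-reflexive)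
            (λ S S-stable → ≤-trans (≤-reflexive (sum-lookup S)) (ι-mono-≤ (ℤ.+≤+ (stable≤α S S-stable))))) _
              (restrict-STAB point∈)

      witness⇒imperfect : LS₊-Imperfect ℝ G
      witness⇒imperfect (LS₊⊆STAB , _) = point∉STAB (LS₊⊆STAB point∈LS₊)

    -- The scaling factor is the inverse of `Y zero zero`, which normalises the corner of the matrix
    -- to 1.
    certificate⇒imperfect : Certificate H → LS₊-Imperfect ℝ G
    certificate⇒imperfect C with inverse (ι (Certificate.Y C zero zero))
      (λ p → ι-mono-< (Certificate.scale>0 C) (≤-reflexive p))
    ... | s , eq = witness⇒imperfect C s (inverse-nonNegative (ι-nonNegative (ℤₚ.<⇒≤ (Certificate.scale>0 C))) eq) eq

-- Concrete graphs, and certificates verified by evaluation.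

joins : ∀ {m} → ℕ → ℕ → Fin m → Fin m → Bool
joins p q i j = (p ℕ.≡ᵇ toℕ i) ∧ (q ℕ.≡ᵇ toℕ j)

adjacent : ∀ {m} → List (ℕ × ℕ) → Fin m → Fin m → Bool
adjacent E i j = any (λ (p , q) → joins p q i j ∨ joins p q j i) E

adjacent-sym : ∀ {m} E (i j : Fin m) → adjacent E i j ≡ adjacent E j i
adjacent-sym []      i j = refl
adjacent-sym ((p , q) ∷ E) i j =
  ≡.cong₂ _∨_ (∨-comm (joins p q i j) _) (adjacent-sym E i j)

fromEdges : ∀ m (E : List (ℕ × ℕ)) {irrefl : True (Finₚ.all? λ (i : Fin m) → ¬? (T? (adjacent E i i)))} → Graph m
fromEdges m E {irrefl} = record
  { _∼_      = λ i j → T (adjacent E i j)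
  ; ∼-sym    = λ {i} {j} → ≡.subst T (adjacent-sym E i j)
  ; ∼-irrefl = λ { {i} refl → toWitness irrefl i }
  ; _∼?_     = λ i j → T? (adjacent E i j)
  }

feasible? : ∀ {m} (H : Graph m) z → Dec (Feasible H z)
feasible? H z = Finₚ.all? (λ p → (+ 0 ℤₚ.≤? z p) ×-dec (z p ℤₚ.≤? z zero))
  ×-dec Finₚ.all? (λ i → Finₚ.all? λ j → (i ∼? j) →-dec (z (suc i) ℤ.+ z (suc j) ℤₚ.≤? z zero))
  where open Graph H

stable? : ∀ {m} (H : Graph m) S → Dec (Stable H S)
stable? H S = Finₚ.all? λ i → Finₚ.all? λ j → (i ∈? S) →-dec ((j ∈? S) →-dec ¬? (i ∼? j))
  where open Graph H

-- Searches all subsets for a stable set that is too large; the cheap size test comes first.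
stable≤? : ∀ {m} (H : Graph m) α → Dec (∀ S → Stable H S → ∣ S ∣ ℕ.≤ α)
stable≤? H α with anySubset? (λ S → ¬? (∣ S ∣ ℕₚ.≤? α) ×-dec stable? H S)
... | yes (S , large , S-stable) = no λ bound → large (bound S S-stable)
... | no none = yes λ S S-stable → decidable-stable (∣ S ∣ ℕₚ.≤? α) λ large → none (S , large , S-stable)

module _ {m k} (H : Graph m) (Y : Vec (Vec ℤ (ℕ.suc m)) (ℕ.suc m)) (multiple : ℤ)
         (w : Vec ℤ k) (L : Vec (Vec ℤ (ℕ.suc m)) k) (α : ℕ) where
  private
    y : Fin (ℕ.suc m) → Fin (ℕ.suc m) → ℤ
    y p q = lookup (lookup Y p) q

  -- Every condition is decidable over ℤ, so each is an implicit `True` argument that evaluation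
  -- fills in for concrete data.
  certify :
    {_ : True (Finₚ.all? λ p → Finₚ.all? λ q → y p q ℤₚ.≟ y q p)}
    {_ : True (Finₚ.all? λ p → y p zero ℤₚ.≟ y p p)}
    {_ : True (+ 0 ℤₚ.<? y zero zero)}
    {_ : True (feasible? H λ p → y p zero)}
    {_ : True (Finₚ.all? λ i → feasible? H λ p → y p (suc i))}
    {_ : True (Finₚ.all? λ i → feasible? H λ p → y p zero ℤ.- y p (suc i))}
    {_ : True (+ 0 ℤₚ.<? multiple)}
    {_ : True (Finₚ.all? λ r → + 0 ℤₚ.≤? lookup w r)}
    {_ : True (Finₚ.all? λ p → Finₚ.all? λ q → multiple ℤ.* y p q ℤₚ.≟
               ℤΣ.sum λ r → lookup w r ℤ.* (lookup (lookup L r) p ℤ.* lookup (lookup L r) q))}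
    {_ : True (stable≤? H α)}
    {_ : True (y zero zero ℤ.* + α ℤₚ.<? ℤΣ.sum λ i → y (suc i) zero)} →
    Certificate H
  certify {a} {b} {c} {d} {e} {f} {g} {h} {i} {j} {l} = record
    { Y = y ; Y-sym = toWitness a ; Y-diag = toWitness b ; scale>0 = toWitness c
    ; feasible₀ = toWitness d ; feasible = toWitness e ; feasible′ = toWitness f
    ; rank = k ; multiple = multiple ; multiple>0 = toWitness g ; w = lookup w ; w≥0 = toWitness h
    ; L = λ r → lookup (lookup L r) ; gram = toWitness i ; α = α ; stable≤α = toWitness j ; violated = toWitness l
    }

module Certificates where
  open import Agda.Builtin.FromNat using (Number; fromNat)
  open import Agda.Builtin.FromNeg using (Negative; fromNeg)
  import Data.Integer.Literals as ℤLit
  import Data.Nat.Literals as ℕLit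

  private
    instance
      ℕ-number : Number ℕ
      ℕ-number = ℕLit.number
      ℤ-number : Number ℤ
      ℤ-number = ℤLit.number
      ℤ-negative : Negative ℤ
      ℤ-negative = ℤLit.negative

  -- The graphs G_LT and G_EMN of Lipták–Tunçel and Escalante–Montelar–Nasini, and two
  -- triangles joined by paths of lengths 1, 2, 2.  The matrices were found by rounding
  -- numerical maximisers of x(V) over LS₊ (ESTAB), the squares by an LDLᵀ factorisation.
  LT : Graph 6
  LT = fromEdges 6
    ((0 , 1) ∷ (1 , 2) ∷ (2 , 3) ∷ (3 , 4) ∷ (4 , 0) ∷ (5 , 4) ∷ (5 , 0) ∷ (5 , 1) ∷ [])

  LT-certificate : Certificate LT
  LT-certificate = certify LT
    -- Below its corner, column zero sums to 126, against 2 · 62 = 124.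
    ( (62 ∷  6 ∷ 36 ∷ 21 ∷ 21 ∷ 36 ∷  6 ∷ [])
    ∷ ( 6 ∷  6 ∷  0 ∷  3 ∷  3 ∷  0 ∷  0 ∷ [])
    ∷ (36 ∷  0 ∷ 36 ∷  0 ∷ 18 ∷ 18 ∷  0 ∷ [])
    ∷ (21 ∷  3 ∷  0 ∷ 21 ∷  0 ∷ 18 ∷  3 ∷ [])
    ∷ (21 ∷  3 ∷ 18 ∷  0 ∷ 21 ∷  0 ∷  3 ∷ [])
    ∷ (36 ∷  0 ∷ 18 ∷ 18 ∷  0 ∷ 36 ∷  0 ∷ [])
    ∷ ( 6 ∷  0 ∷  0 ∷  3 ∷  3 ∷  0 ∷  6 ∷ []) ∷ [] )
    2
    (3 ∷ 3 ∷ 1 ∷ 1 ∷ 1 ∷ 1 ∷ [])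
    ( ( 2 ∷  0 ∷  0 ∷  1 ∷  1 ∷  0 ∷  2 ∷ [])
    ∷ ( 2 ∷  2 ∷  0 ∷  1 ∷  1 ∷  0 ∷  0 ∷ [])
    ∷ ( 5 ∷  0 ∷  6 ∷ -1 ∷  6 ∷  0 ∷  0 ∷ [])
    ∷ ( 7 ∷  0 ∷  6 ∷  1 ∷  0 ∷  6 ∷  0 ∷ [])
    ∷ ( 5 ∷  0 ∷  0 ∷  5 ∷  0 ∷  6 ∷  0 ∷ [])
    ∷ ( 1 ∷  0 ∷  0 ∷  3 ∷  0 ∷  0 ∷  0 ∷ []) ∷ [] )
    2

  EMN : Graph 6
  EMN = fromEdges 6
    ((0 , 1) ∷ (1 , 2) ∷ (2 , 3) ∷ (3 , 4) ∷ (4 , 0) ∷ (5 , 0) ∷ (5 , 1) ∷ (5 , 2) ∷ (5 , 3) ∷ [])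

  EMN-certificate : Certificate EMN
  EMN-certificate = certify EMN
    -- Below its corner, column zero sums to 153, against 2 · 76 = 152.
    ( (76 ∷ 30 ∷ 30 ∷ 30 ∷ 30 ∷ 30 ∷  3 ∷ [])
    ∷ (30 ∷ 30 ∷  0 ∷ 15 ∷ 15 ∷  0 ∷  0 ∷ [])
    ∷ (30 ∷  0 ∷ 30 ∷  0 ∷ 15 ∷ 15 ∷  0 ∷ [])
    ∷ (30 ∷ 15 ∷  0 ∷ 30 ∷  0 ∷ 15 ∷  0 ∷ [])
    ∷ (30 ∷ 15 ∷ 15 ∷  0 ∷ 30 ∷  0 ∷  0 ∷ [])
    ∷ (30 ∷  0 ∷ 15 ∷ 15 ∷  0 ∷ 30 ∷  3 ∷ [])
    ∷ ( 3 ∷  0 ∷  0 ∷  0 ∷  0 ∷  3 ∷  3 ∷ []) ∷ [] )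
    4
    (30 ∷ 10 ∷ 5 ∷ 3 ∷ 3 ∷ 1 ∷ [])
    ( ( 2 ∷  2 ∷  0 ∷  1 ∷  1 ∷  0 ∷  0 ∷ [])
    ∷ ( 2 ∷  0 ∷  2 ∷ -1 ∷  3 ∷  0 ∷  0 ∷ [])
    ∷ ( 4 ∷  0 ∷  1 ∷  4 ∷  0 ∷  3 ∷  0 ∷ [])
    ∷ ( 4 ∷  0 ∷  5 ∷  0 ∷  0 ∷  3 ∷  0 ∷ [])
    ∷ ( 2 ∷  0 ∷  0 ∷  0 ∷  0 ∷  4 ∷  1 ∷ [])
    ∷ ( 2 ∷  0 ∷  0 ∷  0 ∷  0 ∷  0 ∷  3 ∷ []) ∷ [] )
    2

  Prism : Graph 8
  Prism = fromEdges 8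
    ((0 , 1) ∷ (0 , 2) ∷ (1 , 2) ∷ (3 , 4) ∷ (3 , 5) ∷ (4 , 5) ∷ (0 , 3) ∷ (1 , 6) ∷ (6 , 4) ∷ (2 , 7) ∷ (7 , 5) ∷ [])

  Prism-certificate : Certificate Prism
  Prism-certificate = certify Prism
    -- Below its corner, column zero sums to 106, against 3 · 35 = 105.
    ( (35 ∷ 13 ∷  9 ∷  9 ∷ 13 ∷  9 ∷  9 ∷ 22 ∷ 22 ∷ [])
    ∷ (13 ∷ 13 ∷  0 ∷  0 ∷  0 ∷  4 ∷  4 ∷  9 ∷  9 ∷ [])
    ∷ ( 9 ∷  0 ∷  9 ∷  0 ∷  4 ∷  5 ∷  1 ∷  0 ∷  8 ∷ [])
    ∷ ( 9 ∷  0 ∷  0 ∷  9 ∷  4 ∷  1 ∷  5 ∷  8 ∷  0 ∷ [])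
    ∷ (13 ∷  0 ∷  4 ∷  4 ∷ 13 ∷  0 ∷  0 ∷  9 ∷  9 ∷ [])
    ∷ ( 9 ∷  4 ∷  5 ∷  1 ∷  0 ∷  9 ∷  0 ∷  0 ∷  8 ∷ [])
    ∷ ( 9 ∷  4 ∷  1 ∷  5 ∷  0 ∷  0 ∷  9 ∷  8 ∷  0 ∷ [])
    ∷ (22 ∷  9 ∷  0 ∷  8 ∷  9 ∷  0 ∷  8 ∷ 22 ∷ 12 ∷ [])
    ∷ (22 ∷  9 ∷  8 ∷  0 ∷  9 ∷  8 ∷  0 ∷ 12 ∷ 22 ∷ []) ∷ [] )
    51480
    (2340 ∷ 5720 ∷ 12870 ∷ 286 ∷ 20 ∷ 110 ∷ 65 ∷ 2275 ∷ 1144 ∷ [])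
    ( ( 22 ∷   9 ∷   8 ∷   0 ∷   9 ∷   8 ∷   0 ∷  12 ∷  22 ∷ [])
    ∷ (  9 ∷   4 ∷   1 ∷   5 ∷   0 ∷   0 ∷   9 ∷   8 ∷   0 ∷ [])
    ∷ (  4 ∷   0 ∷   0 ∷   4 ∷   4 ∷   1 ∷   0 ∷   2 ∷   0 ∷ [])
    ∷ (  0 ∷ -20 ∷  -5 ∷  20 ∷   0 ∷   0 ∷   0 ∷  14 ∷   0 ∷ [])
    ∷ (  0 ∷ 117 ∷ -94 ∷   0 ∷ -81 ∷  16 ∷   0 ∷  46 ∷   0 ∷ [])
    ∷ (  0 ∷   0 ∷ -29 ∷   0 ∷  36 ∷ -49 ∷   0 ∷  46 ∷   0 ∷ [])
    ∷ (  0 ∷   0 ∷ -13 ∷   0 ∷   0 ∷  22 ∷   0 ∷ -12 ∷   0 ∷ [])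
    ∷ (  0 ∷   0 ∷   3 ∷   0 ∷   0 ∷   0 ∷   0 ∷  -4 ∷   0 ∷ [])
    ∷ (  0 ∷   0 ∷   0 ∷   0 ∷   0 ∷   0 ∷   0 ∷   1 ∷   0 ∷ []) ∷ [] )
    3

-- Non-adjacency, induced patterns and stable triples.

comprehension : ∀ {n} {P : Pred (Fin n) 0ℓ} → Decidable P → Subset n
comprehension P? = tabulate λ i → does (P? i)

comprehension⁺ : ∀ {n} {P : Pred (Fin n) 0ℓ} (P? : Decidable P) {i} → P i → i ∈ comprehension P?
comprehension⁺ P? {i} p = lookup⇒[]= i _ (≡.trans (lookup∘tabulate (does ∘ P?) i) (dec-true (P? i) p))

comprehension⁻ : ∀ {n} {P : Pred (Fin n) 0ℓ} (P? : Decidable P) {i} → i ∈ comprehension P? → P i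
comprehension⁻ P? {i} i∈ with P? i | ≡.trans (≡.sym (lookup∘tabulate (does ∘ P?) i)) ([]=⇒lookup i∈)
... | yes p | _ = p

module NonAdjacency {n} (G : Graph n) where
  open Graph G public

  infix 4 _≁_ _≁?_

  -- Distinctness is included, so that any two vertices of a listed pattern are distinct without
  -- further proof: adjacent ones by irreflexivity, the others by this definition.
  _≁_ : (x y : Fin n) → Set
  x ≁ y = x ≢ y × ¬ x ∼ y

  _≁?_ : Decidable₂ _≁_
  x ≁? y = ¬? (x Finₚ.≟ y) ×-dec ¬? (x ∼? y)

  ≁-sym : ∀ {x y} → x ≁ y → y ≁ x
  ≁-sym (x≢y , x≁y) = x≢y ∘ ≡.sym , x≁y ∘ ∼-sym

  ∼-stable : ∀ {x y} → x ≢ y → ¬ x ≁ y → x ∼ y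
  ∼-stable {x} {y} x≢y p = decidable-stable (x ∼? y) λ x≁y → p (x≢y , x≁y)

  ≢-by : ∀ {x y z} → x ∼ z → ¬ y ∼ z → x ≢ y
  ≢-by x∼z y≁z refl = y≁z x∼z

  Related : Bool → Fin n → Fin n → Set
  Related b x y = if b then x ∼ y else x ≁ y

  Related-sym : ∀ b {x y} → Related b x y → Related b y x
  Related-sym true  = ∼-sym
  Related-sym false = ≁-sym

  Row : ∀ {m} → (Fin m → Bool) → Fin n → Vec (Fin n) m → Set
  Row b x []       = ⊤
  Row b x (y ∷ ys) = Related (b zero) x y × Row (b ∘ suc) x ys

  -- The upper triangle of an adjacency matrix, row by row. For a concrete graph it computes to a
  -- nested tuple of adjacencies and non-adjacencies, each row ending in `tt`.
  Pattern : ∀ {m} → (Fin m → Fin m → Bool) → Vec (Fin n) m → Set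
  Pattern b []       = ⊤
  Pattern b (x ∷ xs) = Row (b zero ∘ suc) x xs × Pattern (λ i j → b (suc i) (suc j)) xs

  row : ∀ {m} {b : Fin m → Bool} {x} {ys : Vec (Fin n) m} → Row b x ys → ∀ j → Related (b j) x (lookup ys j)
  row {ys = y ∷ ys} (p , _)  zero    = p
  row {ys = y ∷ ys} (_ , ps) (suc j) = row ps j

  pattern-at : ∀ {m} {b : Fin m → Fin m → Bool} (b-sym : ∀ i j → b i j ≡ b j i) {xs : Vec (Fin n) m} →
            Pattern b xs → ∀ i j → i ≢ j → Related (b i j) (lookup xs i) (lookup xs j)
  pattern-at b-sym {x ∷ xs} (p , ps) zero    zero    i≢j = ⊥-elim (i≢j refl)
  pattern-at b-sym {x ∷ xs} (p , ps) zero    (suc j) i≢j = row p j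
  pattern-at {b = b} b-sym {x ∷ xs} (p , ps) (suc i) zero i≢j =
    ≡.subst (λ c → Related c (lookup xs i) x) (b-sym zero (suc i)) (Related-sym (b zero (suc i)) (row p i))
  pattern-at b-sym {x ∷ xs} (p , ps) (suc i) (suc j) i≢j =
    pattern-at (λ i j → b-sym (suc i) (suc j)) ps i j (i≢j ∘ ≡.cong suc)

  module _ {m} (H : Graph m) where
    private module H = Graph H

    induced : (xs : Vec (Fin n) m) → Pattern (λ i j → does (i H.∼? j)) xs → H InducedIn G
    induced xs ps = record { f = lookup xs ; injective = injective _ _ ; preserves = preserves ; reflects = reflects }
      where
      does-sym : ∀ i j → does (i H.∼? j) ≡ does (j H.∼? i)
      does-sym i j with i H.∼? j | j H.∼? i
      ... | yes _   | yes _   = refl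
      ... | no  _   | no  _   = refl
      ... | yes i∼j | no  j≁i = ⊥-elim (j≁i (H.∼-sym i∼j))
      ... | no  i≁j | yes j∼i = ⊥-elim (i≁j (H.∼-sym j∼i))
      related : ∀ i j → i ≢ j → Related (does (i H.∼? j)) (lookup xs i) (lookup xs j)
      related = pattern-at does-sym ps
      injective : ∀ i j → lookup xs i ≡ lookup xs j → i ≡ j
      injective i j eq with i Finₚ.≟ j
      ... | yes i≡j = i≡j
      ... | no i≢j with does (i H.∼? j) | related i j i≢j
      ... | true  | p = ⊥-elim (∼-irrefl eq p)
      ... | false | p = ⊥-elim (proj₁ p eq)
      preserves : ∀ {i j} → i H.∼ j → lookup xs i ∼ lookup xs j
      preserves {i} {j} i∼j with i H.∼? j | related i j (λ i≡j → H.∼-irrefl i≡j i∼j)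
      ... | yes _   | p = p
      ... | no i≁j  | _ = ⊥-elim (i≁j i∼j)
      reflects : ∀ {i j} → lookup xs i ∼ lookup xs j → i H.∼ j
      reflects {i} {j} p with i Finₚ.≟ j
      ... | yes refl = ⊥-elim (∼-irrefl refl p)
      ... | no i≢j with i H.∼? j | related i j i≢j
      ... | yes i∼j | _ = i∼j
      ... | no _    | q = ⊥-elim (proj₂ q p)

  -- Listed in cyclic order.
  record Pentagon (a b c d e : Fin n) : Set where
    constructor pentagon
    field
      ab : a ∼ b
      bc : b ∼ c
      cd : c ∼ d
      de : d ∼ e
      ea : e ∼ a
      ac : a ≁ c
      bd : b ≁ d
      ce : c ≁ e
      da : d ≁ a
      eb : e ≁ b

  record Hub (a b c d e v : Fin n) : Set where
    constructor hub
    field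
      va : v ∼ a
      vb : v ∼ b
      vc : v ∼ c
      vd : v ∼ d
      ve : v ∼ e

  clawFree⇒ : ClawFree G → ∀ {c x y z} → c ∼ x → c ∼ y → c ∼ z → x ≁ y → x ≁ z → y ≁ z → ⊥
  clawFree⇒ claw-free {c} {x} {y} {z} cx cy cz xy xz yz =
    claw-free (induced K₁,₃ (c ∷ x ∷ y ∷ z ∷ []) ((cx , cy , cz , tt) , (xy , xz , tt) , (yz , tt) , tt , tt))

  module _ (α : StabilityNumber G 3) where

    α≤3 : ∀ {w x y z} → w ≁ x → w ≁ y → w ≁ z → x ≁ y → x ≁ z → y ≁ z → ⊥
    α≤3 {w} {x} {y} {z} wx wy wz xy xz yz = ℕₚ.<⇒≱ 3<∣S∣ (proj₂ α S S-stable)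
      where
      xs : Vec (Fin n) 4
      xs = w ∷ x ∷ y ∷ z ∷ []
      apart : ∀ i j → i ≢ j → lookup xs i ≁ lookup xs j
      apart = pattern-at {b = λ _ _ → false} (λ _ _ → refl) ((wx , wy , wz , tt) , (xy , xz , tt) , (yz , tt) , tt ,
        tt)
      Member : Pred (Fin n) 0ℓ
      Member v = ∃[ i ] lookup xs i ≡ v
      Member? : Decidable Member
      Member? v = Finₚ.any? λ i → lookup xs i Finₚ.≟ v
      S : Subset n
      S = comprehension Member?
      ∈S : ∀ {i} → Member i → i ∈ S
      ∈S = comprehension⁺ Member?
      3<∣S∣ : 3 ℕ.< ∣ S ∣
      -- Deleting `w`, `x`, `y`, `z` in turn lowers the size strictly four times.
      3<∣S∣ = ℕₚ.≤-<-trans (ℕₚ.≤-<-trans (ℕₚ.≤-<-trans (ℕₚ.≤-<-trans ℕ.z≤n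
        (x∈p⇒∣p-x∣<∣p∣ (x∈p∧x≢y⇒x∈p-y (x∈p∧x≢y⇒x∈p-y (x∈p∧x≢y⇒x∈p-y (∈S (# 3 , refl))
          (≡.≢-sym (proj₁ wz))) (≡.≢-sym (proj₁ xz))) (≡.≢-sym (proj₁ yz)))))
        (x∈p⇒∣p-x∣<∣p∣ (x∈p∧x≢y⇒x∈p-y (x∈p∧x≢y⇒x∈p-y (∈S (# 2 , refl)) (≡.≢-sym (proj₁ wy))) (≡.≢-sym (proj₁ xy)))))
        (x∈p⇒∣p-x∣<∣p∣ (x∈p∧x≢y⇒x∈p-y (∈S (# 1 , refl)) (≡.≢-sym (proj₁ wx)))))
        (x∈p⇒∣p-x∣<∣p∣ (∈S (# 0 , refl)))
      stable : ∀ {u v} → Member u → Member v → ¬ u ∼ v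
      stable (i , refl) (j , refl) with i Finₚ.≟ j
      ... | yes refl = ∼-irrefl refl
      ... | no i≢j   = proj₂ (apart i j i≢j)
      S-stable : Stable G S
      S-stable i j i∈ j∈ = stable (comprehension⁻ Member? i∈) (comprehension⁻ Member? j∈)

    stable-triple : ∃[ x ] ∃[ y ] ∃[ z ] x ≁ y × x ≁ z × y ≁ z
    stable-triple = triple (proj₁ α)
      where
      pick : ∀ {m k} (S : Subset m) → ∣ S ∣ ≡ ℕ.suc k → ∃[ x ] ∃[ T ] x ∈ S × x ∉ T × T Subset.⊆ S × ∣ T ∣ ≡ k
      pick (true ∷ S)  eq = zero , false ∷ S , here , (λ ()) , (λ { (there p) → there p }) , ℕₚ.suc-injective eq
      pick (false ∷ S) eq with pick S eq
      ... | x , T , x∈S , x∉T , T⊆S , ∣T∣ =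
        suc x , false ∷ T , there x∈S , (λ { (there p) → x∉T p }) , (λ { (there p) → there (T⊆S p) }) , ∣T∣
      triple : ∃[ S ] Stable G S × ∣ S ∣ ≡ 3 → ∃[ x ] ∃[ y ] ∃[ z ] x ≁ y × x ≁ z × y ≁ z
      triple (S , S-stable , ∣S∣) with pick S ∣S∣
      ... | x , T , x∈S , x∉T , T⊆S , ∣T∣ with pick T ∣T∣
      ... | y , U , y∈T , y∉U , U⊆T , ∣U∣ with pick U ∣U∣
      ... | z , _ , z∈U , _ = x , y , z
        , ((λ { refl → x∉T y∈T }) , S-stable x y x∈S (T⊆S y∈T))
        , ((λ { refl → x∉T (U⊆T z∈U) }) , S-stable x z x∈S (T⊆S (U⊆T z∈U)))
        , ((λ { refl → y∉U z∈U }) , S-stable y z (T⊆S y∈T) (T⊆S (U⊆T z∈U)))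

  -- Covering a neighbourhood by two cliques.

  module ClawFreeness (claw-free : ClawFree G) where

    claw : ∀ {c x y z} → c ∼ x → c ∼ y → c ∼ z → x ≁ y → x ≁ z → y ≁ z → ⊥
    claw = clawFree⇒ claw-free

    TwoCliques : Fin n → Set
    TwoCliques v = ∃[ Q₁ ] ∃[ Q₂ ] Clique G Q₁ × Clique G Q₂ × Q₁ ∪ Q₂ ≡ neighbourhood G v × Empty (Q₁ ∩ Q₂)

    -- `P` and its negation are the colours of a proper 2-colouring of the complement of the
    -- neighbourhood; each colour class is then a clique.
    two-cliques : ∀ {v} {P : Pred (Fin n) 0ℓ} → Decidable P →
      (∀ {x y} → v ∼ x → v ∼ y → x ≁ y → P x → P y → ⊥) → (∀ {x y} → v ∼ x → v ∼ y → x ≁ y → ¬ P x → ¬ P y → ⊥) →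
      TwoCliques v
    two-cliques {v} {P} P? p ¬p = comprehension in? , comprehension out? ,
      (λ i j i∈ j∈ i≢j → let (vi , pi) = comprehension⁻ in? i∈ ; (vj , pj) = comprehension⁻ in? j∈ in
         ∼-stable i≢j λ i≁j → p vi vj i≁j pi pj) ,
      (λ i j i∈ j∈ i≢j → let (vi , pi) = comprehension⁻ out? i∈ ; (vj , pj) = comprehension⁻ out? j∈ in
         ∼-stable i≢j λ i≁j → ¬p vi vj i≁j pi pj) ,
      ⊆-antisym (λ i∈ → comprehension⁺ (v ∼?_) ([ proj₁ ∘ comprehension⁻ in? ,
        proj₁ ∘ comprehension⁻ out? ]′ (x∈p∪q⁻ _ _ i∈)))
                (λ {i} i∈ → x∈p∪q⁺ (place (comprehension⁻ (v ∼?_) i∈) (P? i))) ,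
      λ (i , i∈) → let (i∈Q₁ , i∈Q₂) = x∈p∩q⁻ _ _ i∈ in proj₂ (comprehension⁻ out? i∈Q₂) (proj₂ (comprehension⁻ in? i∈Q₁))
      where
      in?  = λ i → (v ∼? i) ×-dec P? i
      out? = λ i → (v ∼? i) ×-dec ¬? (P? i)
      place : ∀ {i} → v ∼ i → Dec (P i) → i ∈ comprehension in? ⊎ i ∈ comprehension out?
      place vi (yes q) = inj₁ (comprehension⁺ in? (vi , q))
      place vi (no q)  = inj₂ (comprehension⁺ out? (vi , q))

    -- Fouquet's theorem, with the absence of simplicial vertices in place of
    -- connectedness.  For u at distance two from v, K = N(u) ∩ N(v) and
    -- L = N(v) ∖ N(u).
    module Fouquet
      (no-wheel : ∀ {v a b c d e} → Pentagon a b c d e → Hub a b c d e v → ⊥)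
      (not-simplicial : ∀ {z u} → z ≁ u → (∀ {r r′} → r ∼ z → r′ ∼ z → r ≢ r′ → r ∼ r′) → ⊥)
      (α : StabilityNumber G 3) (v : Fin n) where

      private
        -- A chord of the walk among the non-edges would close a claw at v, so the
        -- walk is the complement of an induced 5-cycle, hence induces a 5-cycle.
        no-5-walk : ∀ {x₀ x₁ x₂ x₃ x₄} → v ∼ x₀ → v ∼ x₁ → v ∼ x₂ → v ∼ x₃ → v ∼ x₄ →
                    x₀ ≁ x₁ → x₁ ≁ x₂ → x₂ ≁ x₃ → x₃ ≁ x₄ → x₄ ≁ x₀ → ⊥
        no-5-walk v₀ v₁ v₂ v₃ v₄ n₀₁ n₁₂ n₂₃ n₃₄ n₄₀ = no-wheel
          (pentagon (chord v₀ v₁ v₂ v₃ v₄ n₀₁ n₁₂ n₂₃ n₃₄ n₄₀) (chord v₂ v₃ v₄ v₀ v₁ n₂₃ n₃₄ n₄₀ n₀₁ n₁₂)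
            (chord v₄ v₀ v₁ v₂ v₃ n₄₀ n₀₁ n₁₂ n₂₃ n₃₄) (chord v₁ v₂ v₃ v₄ v₀ n₁₂ n₂₃ n₃₄ n₄₀ n₀₁)
            (chord v₃ v₄ v₀ v₁ v₂ n₃₄ n₄₀ n₀₁ n₁₂ n₂₃)
            (≁-sym n₄₀) (≁-sym n₁₂) (≁-sym n₃₄) (≁-sym n₀₁) (≁-sym n₂₃))
          (hub v₀ v₂ v₄ v₁ v₃)
          where
          chord : ∀ {x₀ x₁ x₂ x₃ x₄} → v ∼ x₀ → v ∼ x₁ → v ∼ x₂ → v ∼ x₃ → v ∼ x₄ →
                  x₀ ≁ x₁ → x₁ ≁ x₂ → x₂ ≁ x₃ → x₃ ≁ x₄ → x₄ ≁ x₀ → x₀ ∼ x₂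
          chord {x₀} {_} {x₂} v₀ v₁ v₂ v₃ v₄ n₀₁ n₁₂ n₂₃ n₃₄ n₄₀ with x₀ Finₚ.≟ x₂
          -- If the walk returns to `x₀` after two steps, its other three steps form a triangle of
          -- non-edges, again a claw at `v`.
          ... | yes refl = ⊥-elim (claw v₀ v₃ v₄ n₂₃ (≁-sym n₄₀) n₃₄)
          ... | no x₀≢x₂ = ∼-stable x₀≢x₂ λ n₀₂ → claw v₀ v₁ v₂ n₀₁ n₀₂ n₁₂

        InK : Fin n → Fin n → Set
        InK u k = v ∼ k × u ∼ k

        side-cliques : ∀ {u} → (∀ {x y} → InK u x → InK u y → x ≁ y → ⊥) →
                       (∀ {x y} → v ∼ x → v ∼ y → ¬ u ∼ x → ¬ u ∼ y → x ≁ y → ⊥) → TwoCliques v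
        side-cliques {u} K-clique L-clique = two-cliques (u ∼?_)
          (λ vx vy x≁y ux uy → K-clique (vx , ux) (vy , uy) x≁y) (λ vx vy x≁y ux uy → L-clique vx vy ux uy x≁y)

        module _ {u a b c} (u≁v : u ≁ v) (a∈K : InK u a) (a≁b : a ≁ b) (vb : v ∼ b) (vc : v ∼ c)
                 (ub : ¬ u ∼ b) (uc : ¬ u ∼ c) (b≁c : b ≁ c) where

          private
            Misses : Fin n → Fin n → Set
            Misses x k = InK u k × k ≁ b × k ≁ x
            -- Models odd distance from `b` in the complement of the neighbourhood of `v`. Even are
            -- `b`, the vertices of L reached from `b` through K, and the vertices of K adjacent to
            -- `b`, all of which miss `c`. Two even vertices missing each other close a claw at `v`
            -- or a walk of five non-edges.
            Side : Fin n → Set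
            Side x = (u ∼ x × ¬ x ∼ b) ⊎ (¬ u ∼ x × ¬ ∃ (Misses x))
            misses? : ∀ x → Dec (∃ (Misses x))
            misses? x = Finₚ.any? λ k → ((v ∼? k) ×-dec (u ∼? k)) ×-dec ((k ≁? b) ×-dec (k ≁? x))
            side? : Decidable Side
            side? x = ((u ∼? x) ×-dec ¬? (x ∼? b)) ⊎-dec (¬? (u ∼? x) ×-dec ¬? (misses? x))

            u≁ : ∀ {x} → v ∼ x → ¬ u ∼ x → u ≁ x
            u≁ vx ux = (λ { refl → proj₂ u≁v (∼-sym vx) }) , ux
            misses-one : ∀ {k x y} → InK u k → v ∼ x → v ∼ y → ¬ u ∼ x → ¬ u ∼ y → x ≁ y → k ∼ x → ¬ k ∼ y
            misses-one (_ , uk) vx vy ux uy x≁y kx ky = claw (∼-sym uk) kx ky (u≁ vx ux) (u≁ vy uy) x≁y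
            apart : ∀ {x y} → u ∼ x → ¬ u ∼ y → ¬ x ∼ y → x ≁ y
            apart ux uy xy = (λ { refl → uy ux }) , xy
            misses-c : ∀ {x} → v ∼ x → u ∼ x → x ∼ b → x ≁ c
            misses-c vx ux xb = apart ux uc (misses-one (vx , ux) vb vc ub uc b≁c xb)
            ∼b : ∀ {x} → u ∼ x → ¬ Side x → x ∼ b
            ∼b {x} ux s = decidable-stable (x ∼? b) λ xb → s (inj₁ (ux , xb))
            missed : ∀ {x} → ¬ u ∼ x → ¬ Side x → ∃ (Misses x)
            missed {x} ux s = decidable-stable (misses? x) λ m → s (inj₂ (ux , m))

          split-by-distance-2 : TwoCliques v
          split-by-distance-2 = two-cliques side? same other
            where
            same : ∀ {x y} → v ∼ x → v ∼ y → x ≁ y → Side x → Side y → ⊥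
            same vx vy xy (inj₁ (ux , xb)) (inj₁ (uy , yb)) = claw vx vy vb xy (apart ux ub xb) (apart uy ub yb)
            same vx vy xy (inj₁ (ux , xb)) (inj₂ (uy , m))  = m (_ , (vx , ux) , apart ux ub xb , xy)
            same vx vy xy (inj₂ (ux , m))  (inj₁ (uy , yb)) = m (_ , (vy , uy) , apart uy ub yb , ≁-sym xy)
            same {x} {y} vx vy xy (inj₂ (ux , m)) (inj₂ (uy , m′)) with a ∼? x | a ∼? y
            ... | no ax  | _      = m (a , a∈K , a≁b , apart (proj₂ a∈K) ux ax)
            ... | yes _  | no ay  = m′ (a , a∈K , a≁b , apart (proj₂ a∈K) uy ay)
            ... | yes ax | yes ay = misses-one a∈K vx vy ux uy xy ax ay
            other : ∀ {x y} → v ∼ x → v ∼ y → x ≁ y → ¬ Side x → ¬ Side y → ⊥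
            other {x} {y} vx vy xy sx sy with u ∼? x | u ∼? y
            ... | yes ux | yes uy = claw vx vy vc xy (misses-c vx ux (∼b ux sx)) (misses-c vy uy (∼b uy sy))
            ... | yes ux | no uy with missed uy sy
            ... | k , (vk , _) , kb , ky = no-5-walk vy vk vb vc vx (≁-sym ky) kb b≁c
              (≁-sym (misses-c vx ux (∼b ux sx))) xy
            other {x} {y} vx vy xy sx sy | no ux | yes uy with missed ux sx
            ... | k , (vk , _) , kb , kx = no-5-walk vx vk vb vc vy (≁-sym kx) kb b≁c
              (≁-sym (misses-c vy uy (∼b uy sy))) (≁-sym xy)
            other {x} {y} vx vy xy sx sy | no ux | no uy with missed ux sx | missed uy sy
            ... | k , (vk , _) , kb , kx | k′ , (vk′ , _) , k′b , k′y =
              no-5-walk vx vk vb vk′ vy (≁-sym kx) kb (≁-sym k′b) k′y (≁-sym xy)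

        Distance2 : Fin n → Set
        Distance2 u = u ≁ v × ∃ (InK u)

        distance2? : Decidable Distance2
        distance2? u = (u ≁? v) ×-dec Finₚ.any? λ a → (v ∼? a) ×-dec (u ∼? a)

        L-nonEdge? : Dec (∃[ u ] ∃[ b ] ∃[ c ] Distance2 u × v ∼ b × v ∼ c × ¬ u ∼ b × ¬ u ∼ c × b ≁ c)
        L-nonEdge? = Finₚ.any? λ u → Finₚ.any? λ b → Finₚ.any? λ c →
          distance2? u ×-dec (v ∼? b) ×-dec (v ∼? c) ×-dec ¬? (u ∼? b) ×-dec ¬? (u ∼? c) ×-dec (b ≁? c)

      neighbourhood-two-cliques : TwoCliques v
      neighbourhood-two-cliques with L-nonEdge?
      ... | yes (u , b , c , (u≁v , a , va , ua) , vb , vc , ub , uc , bc) with a ∼? b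
      ... | no ab  = split-by-distance-2 u≁v (va , ua) ((λ { refl → ub ua }) , ab) vb vc ub uc bc
      -- Since `u`, `b`, `c` cannot be the leaves of a claw at `a`, seeing `b` means missing `c`; so
      -- `b` and `c` trade roles.
      ... | yes ab = split-by-distance-2 u≁v (va , ua) ((λ { refl → uc ua }) , λ ac →
                       claw (∼-sym ua) ab ac ((λ { refl → proj₂ u≁v (∼-sym vb) }) , ub)
                         ((λ { refl → proj₂ u≁v (∼-sym vc) }) , uc) bc)
                       vc vb uc ub (≁-sym bc)
      neighbourhood-two-cliques | no no-L with Finₚ.any? (λ p → Finₚ.any? λ q →
        (v ∼? p) ×-dec (v ∼? q) ×-dec (p ≁? q))
      ... | no clique = two-cliques (λ _ → yes tt) (λ vx vy xy _ _ → clique (_ , _ , vx , vy , xy)) λ _ _ _ ¬⊤ _ →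
        ¬⊤ tt
      ... | yes (p , q , vp , vq , pq) with Finₚ.any? (λ z → (z ≁? v) ×-dec ¬? (distance2? z))
      ... | yes (z , z≁v , z-far) = far (Finₚ.any? λ u → distance2? u ×-dec (u ∼? z))
        where
        no-common : ∀ {z} → z ≁ v → ¬ Distance2 z → ∀ {a} → v ∼ a → z ≁ a
        no-common z≁v z-far va = (λ { refl → proj₂ z≁v (∼-sym va) }) , λ za → z-far (z≁v , _ , va , za)
        far : Dec (∃[ u ] Distance2 u × u ∼ z) → TwoCliques v
        far (yes (u , d@(u≁v , _) , uz)) = side-cliques {u}
          (λ (vx , ux) (vy , uy) xy → claw uz ux uy (no-common z≁v z-far vx) (no-common z≁v z-far vy) xy)
          (λ vx vy ux uy xy → no-L (u , _ , _ , d , vx , vy , ux , uy , xy))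
        -- All neighbours of `z` are now beyond distance two from `v`. Two non-adjacent ones would
        -- form a stable set of size four with `p` and `q`, so `z` is simplicial.
        far (no none) = ⊥-elim (not-simplicial z≁v λ rz r′z r≢r′ → ∼-stable r≢r′ λ rr′ →
          let (r≁v , r-far) = remote rz ; (r′≁v , r′-far) = remote r′z in
          α≤3 α pq (≁-sym (no-common r≁v r-far vp)) (≁-sym (no-common r′≁v r′-far vp))
                   (≁-sym (no-common r≁v r-far vq)) (≁-sym (no-common r′≁v r′-far vq)) rr′)
          where
          remote : ∀ {r} → r ∼ z → r ≁ v × ¬ Distance2 r
          remote rz = ((λ { refl → proj₂ z≁v (∼-sym rz) }) , λ rv → z-far (z≁v , _ , ∼-sym rv , ∼-sym rz)) ,
                      λ d → none (_ , d , rz)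
      -- Every non-neighbour of `v` is now at distance two and has a clique for its L. This prevents
      -- a stable triple from having two vertices in the neighbourhood of `v`, so it supplies two
      -- non-adjacent vertices that both miss `v`.
      ... | no no-far with stable-triple α
      ... | x , y , z , xy , xz , yz = locate (position x) (position y) (position z)
        where
        L-clique : ∀ {u b c} → u ≁ v → v ∼ b → v ∼ c → ¬ u ∼ b → ¬ u ∼ c → b ≁ c → ⊥
        L-clique {u} u≁v vb vc ub uc bc = no-L (u , _ , _ ,
          decidable-stable (distance2? u) (λ f → no-far (u , u≁v , f)) , vb , vc , ub , uc , bc)
        -- N(v) ∩ N(y) avoids N(z), so both it and N(v) ∖ N(y) are cliques.
        pair : ∀ {y z} → y ≁ v → z ≁ v → y ≁ z → TwoCliques v
        pair {y} {z} yv zv yz = side-cliques {y}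
          (λ (va , ya) (vb , yb) ab → L-clique zv va vb (avoid va ya) (avoid vb yb) ab)
          (λ vx vy ux uy xy → L-clique yv vx vy ux uy xy)
          where
          avoid : ∀ {a} → v ∼ a → y ∼ a → ¬ z ∼ a
          avoid va ya za = claw (∼-sym va) (∼-sym ya) (∼-sym za) (≁-sym yv) (≁-sym zv) yz
        Position : Fin n → Set
        Position x = x ≡ v ⊎ v ∼ x ⊎ x ≁ v
        position : ∀ x → Position x
        position x with x Finₚ.≟ v | v ∼? x
        ... | yes x≡v | _      = inj₁ x≡v
        ... | no _    | yes vx = inj₂ (inj₁ vx)
        ... | no x≢v  | no vx  = inj₂ (inj₂ (x≢v , vx ∘ ∼-sym))
        locate : Position x → Position y → Position z → TwoCliques v
        locate (inj₁ refl) _ _ = pair (≁-sym xy) (≁-sym xz) yz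
        locate _ (inj₁ refl) _ = pair xy (≁-sym yz) xz
        locate _ _ (inj₁ refl) = pair xz yz xy
        locate (inj₂ (inj₂ xv)) (inj₂ (inj₂ yv)) _ = pair xv yv xy
        locate (inj₂ (inj₂ xv)) _ (inj₂ (inj₂ zv)) = pair xv zv xz
        locate _ (inj₂ (inj₂ yv)) (inj₂ (inj₂ zv)) = pair yv zv yz
        locate (inj₂ (inj₁ vx)) (inj₂ (inj₁ vy)) (inj₂ (inj₁ vz)) = ⊥-elim (claw vx vy vz xy xz yz)
        locate (inj₂ (inj₁ vx)) (inj₂ (inj₁ vy)) (inj₂ (inj₂ zv)) =
          ⊥-elim (L-clique zv vx vy (proj₂ xz ∘ ∼-sym) (proj₂ yz ∘ ∼-sym) xy)
        locate (inj₂ (inj₁ vx)) (inj₂ (inj₂ yv)) (inj₂ (inj₁ vz)) =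
          ⊥-elim (L-clique yv vx vz (proj₂ xy ∘ ∼-sym) (proj₂ yz) xz)
        locate (inj₂ (inj₂ xv)) (inj₂ (inj₁ vy)) (inj₂ (inj₁ vz)) =
          ⊥-elim (L-clique xv vy vz (proj₂ xy) (proj₂ xz) yz)

-- How the remaining vertices attach to an induced 5-wheel.

module Wheels {n} (G : Graph n) (claw-free : ClawFree G) (α : StabilityNumber G 3) where
  open NonAdjacency G
  open ClawFreeness claw-free using (claw)

  -- A vertex outside the induced 5-cycle a b c d e is a hub, an ear over one of the
  -- edges, or far: claw-freeness leaves only two other attachments, LT and EMN.
  record Ear (a b c d e t : Fin n) : Set where
    constructor ear
    field
      ta : t ∼ a
      tb : t ∼ b
      tc : t ≁ c
      td : t ≁ d
      te : t ≁ e

  record Far (a b c d e z : Fin n) : Set where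
    constructor far
    field
      za : z ≁ a
      zb : z ≁ b
      zc : z ≁ c
      zd : z ≁ d
      ze : z ≁ e

  data Rim (a b c d e : Fin n) : Fin n → Set where
    at-a : Rim a b c d e a
    at-b : Rim a b c d e b
    at-c : Rim a b c d e c
    at-d : Rim a b c d e d
    at-e : Rim a b c d e e

  data Kind (a b c d e u : Fin n) : Set where
    is-rim  : Rim a b c d e u → Kind a b c d e u
    is-hub  : Hub a b c d e u → Kind a b c d e u
    is-ear₁ : Ear a b c d e u → Kind a b c d e u
    is-ear₂ : Ear b c d e a u → Kind a b c d e u
    is-ear₃ : Ear c d e a b u → Kind a b c d e u
    is-ear₄ : Ear d e a b c u → Kind a b c d e u
    is-ear₅ : Ear e a b c d u → Kind a b c d e u
    is-far  : Far a b c d e u → Kind a b c d e u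

  record Wheel (a b c d e v : Fin n) : Set where
    constructor wheel
    field
      cycle  : Pentagon a b c d e
      centre : Hub a b c d e v
    open Pentagon cycle public
    open Hub centre public

  ∼⇒≢ : ∀ {x y} → x ∼ y → x ≢ y
  ∼⇒≢ x∼y x≡y = ∼-irrefl x≡y x∼y

  rotate-cycle : ∀ {a b c d e} → Pentagon a b c d e → Pentagon b c d e a
  rotate-cycle (pentagon ab bc cd de ea ac bd ce da eb) = pentagon bc cd de ea ab bd ce da eb ac

  rotate-hub : ∀ {a b c d e v} → Hub a b c d e v → Hub b c d e a v
  rotate-hub (hub va vb vc vd ve) = hub vb vc vd ve va

  rotate-far : ∀ {a b c d e z} → Far a b c d e z → Far b c d e a z
  rotate-far (far za zb zc zd ze) = far zb zc zd ze za

  rotate-rim : ∀ {a b c d e u} → Rim a b c d e u → Rim b c d e a u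
  rotate-rim at-a = at-e
  rotate-rim at-b = at-a
  rotate-rim at-c = at-b
  rotate-rim at-d = at-c
  rotate-rim at-e = at-d

  rotate-kind : ∀ {a b c d e u} → Kind a b c d e u → Kind b c d e a u
  rotate-kind (is-rim p)  = is-rim (rotate-rim p)
  rotate-kind (is-hub p)  = is-hub (rotate-hub p)
  rotate-kind (is-ear₁ p) = is-ear₅ p
  rotate-kind (is-ear₂ p) = is-ear₁ p
  rotate-kind (is-ear₃ p) = is-ear₂ p
  rotate-kind (is-ear₄ p) = is-ear₃ p
  rotate-kind (is-ear₅ p) = is-ear₄ p
  rotate-kind (is-far p)  = is-far (rotate-far p)

  r¹ : ∀ {a b c d e v} → Wheel a b c d e v → Wheel b c d e a v
  r¹ (wheel p h) = wheel (rotate-cycle p) (rotate-hub h)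

  r² : ∀ {a b c d e v} → Wheel a b c d e v → Wheel c d e a b v
  r² = r¹ ∘ r¹
  r³ : ∀ {a b c d e v} → Wheel a b c d e v → Wheel d e a b c v
  r³ = r¹ ∘ r²
  r⁴ : ∀ {a b c d e v} → Wheel a b c d e v → Wheel e a b c d v
  r⁴ = r¹ ∘ r³

  h² : ∀ {a b c d e v} → Hub a b c d e v → Hub c d e a b v
  h² = rotate-hub ∘ rotate-hub
  h³ : ∀ {a b c d e v} → Hub a b c d e v → Hub d e a b c v
  h³ = rotate-hub ∘ h²

  -- Reflection in the axis through b.
  reflect : ∀ {a b c d e v} → Wheel a b c d e v → Wheel c b a e d v
  reflect (wheel (pentagon ab bc cd de ea ac bd ce da eb) (hub va vb vc vd ve)) =
    wheel (pentagon (∼-sym bc) (∼-sym ab) (∼-sym ea) (∼-sym de) (∼-sym cd) (≁-sym ac) (≁-sym eb) (≁-sym da) (≁-sym ce)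
      (≁-sym bd))
          (hub vc vb va ve vd)

  reflect-hub : ∀ {a b c d e v} → Hub a b c d e v → Hub c b a e d v
  reflect-hub (hub va vb vc vd ve) = hub vc vb va ve vd

  reflect-rim : ∀ {a b c d e u} → Rim a b c d e u → Rim c b a e d u
  reflect-rim at-a = at-c
  reflect-rim at-b = at-b
  reflect-rim at-c = at-a
  reflect-rim at-d = at-e
  reflect-rim at-e = at-d

  reflect-ear : ∀ {a b c d e t} → Ear a b c d e t → Ear b a e d c t
  reflect-ear (ear ta tb tc td te) = ear tb ta te td tc

  module Attachments
    (no-LT  : ∀ {a b c d e t} → Pentagon a b c d e → t ∼ e → t ∼ a → t ∼ b → t ≁ c → t ≁ d → ⊥)
    (no-EMN : ∀ {a b c d e t} → Pentagon a b c d e → t ∼ a → t ∼ b → t ∼ c → t ∼ d → t ≁ e → ⊥)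
    (no-prism : ∀ {p₀ p₁ p₂ p₃ p₄ p₅ p₆ p₇} → Pattern (λ i j → does (Graph._∼?_ Certificates.Prism i j))
                  (p₀ ∷ p₁ ∷ p₂ ∷ p₃ ∷ p₄ ∷ p₅ ∷ p₆ ∷ p₇ ∷ []) → ⊥)
    where

    -- By claw-freeness at a rim vertex, `u` sees it only together with one of its rim neighbours.
    -- So the rim neighbours of `u` form a single run of at least two, and `no-LT` and `no-EMN`
    -- extend a run of three to all five.
    kind : ∀ {a b c d e} → Pentagon a b c d e → ∀ u → Kind a b c d e u
    kind {a} {b} {c} {d} {e} P u with u Finₚ.≟ a | u Finₚ.≟ b | u Finₚ.≟ c | u Finₚ.≟ d | u Finₚ.≟ e
    ... | yes refl | _ | _ | _ | _ = is-rim at-a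
    ... | _ | yes refl | _ | _ | _ = is-rim at-b
    ... | _ | _ | yes refl | _ | _ = is-rim at-c
    ... | _ | _ | _ | yes refl | _ = is-rim at-d
    ... | _ | _ | _ | _ | yes refl = is-rim at-e
    ... | no u≢a | no u≢b | no u≢c | no u≢d | no u≢e = by-adjacency (u ∼? a) (u ∼? b) (u ∼? c) (u ∼? d) (u ∼? e)
      where
      open Pentagon P
      lonely : ∀ {x y z} → x ∼ y → x ∼ z → y ≁ z → u ≢ y → u ≢ z → u ∼ x → ¬ u ∼ y → ¬ u ∼ z → ⊥
      lonely xy xz yz u≢y u≢z ux uy uz = claw xy xz (∼-sym ux) yz (≁-sym (u≢y , uy)) (≁-sym (u≢z , uz))
      three : ∀ {a b c d e} → Pentagon a b c d e → u ≢ c → u ≢ d → u ∼ e → u ∼ a → u ∼ b → u ∼ c × u ∼ d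
      three {a} {b} {c} {d} {e} P u≢c u≢d ue ua ub with u ∼? c | u ∼? d
      ... | yes uc | yes ud = uc , ud
      ... | yes uc | no ud  = ⊥-elim (no-EMN (rotate-cycle (rotate-cycle (rotate-cycle (rotate-cycle P)))) ue ua ub uc
        (u≢d , ud))
      ... | no uc  | yes ud = ⊥-elim (no-EMN (rotate-cycle (rotate-cycle (rotate-cycle P))) ud ue ua ub (u≢c , uc))
      ... | no uc  | no ud  = ⊥-elim (no-LT P ue ua ub (u≢c , uc) (u≢d , ud))
      P₁ = rotate-cycle P
      P₂ = rotate-cycle P₁
      P₃ = rotate-cycle P₂
      P₄ = rotate-cycle P₃
      by-adjacency : Dec (u ∼ a) → Dec (u ∼ b) → Dec (u ∼ c) → Dec (u ∼ d) → Dec (u ∼ e) → Kind a b c d e u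
      by-adjacency (yes ua) (yes ub) _ _ (yes ue) = let (uc , ud) = three P u≢c u≢d ue ua ub in is-hub (hub ua ub uc ud ue)
      by-adjacency (yes ua) (yes ub) (yes uc) _ _ = let (ud , ue) = three P₁ u≢d u≢e ua ub uc in is-hub (hub ua ub uc ud ue)
      by-adjacency _ (yes ub) (yes uc) (yes ud) _ = let (ue , ua) = three P₂ u≢e u≢a ub uc ud in is-hub (hub ua ub uc ud ue)
      by-adjacency _ _ (yes uc) (yes ud) (yes ue) = let (ua , ub) = three P₃ u≢a u≢b uc ud ue in is-hub (hub ua ub uc ud ue)
      by-adjacency (yes ua) _ _ (yes ud) (yes ue) = let (ub , uc) = three P₄ u≢b u≢c ud ue ua in is-hub (hub ua ub uc ud ue)
      by-adjacency (yes ua) (no ub) _ _ (no ue) = ⊥-elim (lonely ab (∼-sym ea) (≁-sym eb) u≢b u≢e ua ub ue)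
      by-adjacency (no ua) (yes ub) (no uc) _ _ = ⊥-elim (lonely (∼-sym ab) bc ac u≢a u≢c ub ua uc)
      by-adjacency _ (no ub) (yes uc) (no ud) _ = ⊥-elim (lonely (∼-sym bc) cd bd u≢b u≢d uc ub ud)
      by-adjacency _ _ (no uc) (yes ud) (no ue) = ⊥-elim (lonely (∼-sym cd) de ce u≢c u≢e ud uc ue)
      by-adjacency (no ua) _ _ (no ud) (yes ue) = ⊥-elim (lonely (∼-sym de) ea da u≢d u≢a ue ud ua)
      by-adjacency (yes ua) (yes ub) (no uc) (no ud) (no ue) = is-ear₁ (ear ua ub (u≢c , uc) (u≢d , ud) (u≢e , ue))
      by-adjacency (no ua) (yes ub) (yes uc) (no ud) (no ue) = is-ear₂ (ear ub uc (u≢d , ud) (u≢e , ue) (u≢a , ua))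
      by-adjacency (no ua) (no ub) (yes uc) (yes ud) (no ue) = is-ear₃ (ear uc ud (u≢e , ue) (u≢a , ua) (u≢b , ub))
      by-adjacency (no ua) (no ub) (no uc) (yes ud) (yes ue) = is-ear₄ (ear ud ue (u≢a , ua) (u≢b , ub) (u≢c , uc))
      by-adjacency (yes ua) (no ub) (no uc) (no ud) (yes ue) = is-ear₅ (ear ue ua (u≢b , ub) (u≢c , uc) (u≢d , ud))
      by-adjacency (no ua) (no ub) (no uc) (no ud) (no ue)   =
        is-far (far (u≢a , ua) (u≢b , ub) (u≢c , uc) (u≢d , ud) (u≢e , ue))

    hub≁ear : ∀ {a b c d e v w t} → Wheel a b c d e v → Hub a b c d e w → Ear a b c d e t → w ≁ t
    hub≁ear W H T = ≢-by (Hub.vc H) (proj₂ (Ear.tc T)) ,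
      λ wt → claw (Hub.vc H) (Hub.ve H) wt (Wheel.ce W) (≁-sym (Ear.tc T)) (≁-sym (Ear.te T))

    hub≁far : ∀ {a b c d e v w z} → Wheel a b c d e v → Hub a b c d e w → Far a b c d e z → w ≁ z
    hub≁far W H Z = ≢-by (Hub.vc H) (proj₂ (Far.zc Z)) ,
      λ wz → claw (Hub.va H) (Hub.vc H) wz (Wheel.ac W) (≁-sym (Far.za Z)) (≁-sym (Far.zc Z))

    rim∼hub : ∀ {a b c d e w r} → Hub a b c d e w → Rim a b c d e r → w ∼ r
    rim∼hub H at-a = Hub.va H
    rim∼hub H at-b = Hub.vb H
    rim∼hub H at-c = Hub.vc H
    rim∼hub H at-d = Hub.vd H
    rim∼hub H at-e = Hub.ve H

    ear∼ear : ∀ {a b c d e v t t′} → Wheel a b c d e v → Ear a b c d e t → Ear a b c d e t′ → t ≢ t′ → t ∼ t′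
    ear∼ear W T T′ t≢t′ = ∼-stable t≢t′
      (claw (∼-sym (Wheel.ea W)) (∼-sym (Ear.ta T)) (∼-sym (Ear.ta T′)) (≁-sym (Ear.te T)) (≁-sym (Ear.te T′)))

    ear∼next : ∀ {a b c d e v t t′} → Wheel a b c d e v → Ear a b c d e t → Ear b c d e a t′ → t ∼ t′
    ear∼next W T T′ = ∼-stable (≢-by (Ear.ta T) (proj₂ (Ear.te T′)))
      (claw (∼-sym (Wheel.vb W)) (∼-sym (Ear.tb T)) (∼-sym (Ear.ta T′))
        (hub≁ear W (Wheel.centre W) T) (hub≁ear (r¹ W) (Wheel.centre (r¹ W)) T′))

    -- Otherwise e, a, t, t′, d is an induced 5-cycle of which the hub sees exactly the three
    -- consecutive vertices d, e, a.
    ear≁skip : ∀ {a b c d e v t t′} → Wheel a b c d e v → Ear a b c d e t → Ear c d e a b t′ → t ≁ t′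
    ear≁skip W T T′ = ≢-by (Ear.ta T) (proj₂ (Ear.td T′)) , λ tt′ →
      no-LT (pentagon ea (∼-sym (Ear.ta T)) tt′ (Ear.tb T′) de (≁-sym (Ear.te T)) (≁-sym (Ear.td T′)) (Ear.td T)
        (Ear.tc T′) da)
        vd ve va (hub≁ear W centre T) (hub≁ear (r² W) (Wheel.centre (r² W)) T′)
      where open Wheel W

    -- The ear is what forces adjacency: with two non-adjacent hubs it would form a claw at `a`.
    hub∼hub : ∀ {a b c d e v t w w′} → Wheel a b c d e v → Ear a b c d e t → Hub a b c d e w → Hub a b c d e w′ →
      w ≢ w′ → w ∼ w′
    hub∼hub W T H H′ w≢w′ = ∼-stable w≢w′ λ ww′ →
      claw (∼-sym (Hub.va H)) (∼-sym (Hub.va H′)) (∼-sym (Ear.ta T)) ww′ (hub≁ear W H T) (hub≁ear W H′ T)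

    far∼ear : ∀ {a b c d e v z t} → Wheel a b c d e v → Far a b c d e z → Ear a b c d e t → z ∼ t
    far∼ear W Z T = ∼-stable (≡.≢-sym (≢-by (Ear.ta T) (proj₂ (Far.za Z)))) λ zt →
      α≤3 α zt (Far.zc Z) (Far.ze Z) (Ear.tc T) (Ear.te T) (Wheel.ce W)

    far∼far : ∀ {a b c d e v z z′} → Wheel a b c d e v → Far a b c d e z → Far a b c d e z′ → z ≢ z′ → z ∼ z′
    far∼far W Z Z′ z≢z′ = ∼-stable z≢z′ λ zz′ → α≤3 α zz′ (Far.za Z) (Far.zc Z) (Far.za Z′) (Far.zc Z′) (Wheel.ac W)

    -- The triangles b t a and c t′ d are joined by the edge bc and the paths t z t′ and a e d.
    far-prism : ∀ {a b c d e v z t t′} → Wheel a b c d e v → Far a b c d e z → Ear a b c d e t → Ear c d e a b t′ → ⊥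
    far-prism W Z T T′ = no-prism
      ( (∼-sym (Ear.tb T) , ∼-sym ab , bc , ≁-sym (Ear.te T′) , bd , ≁-sym (Far.zb Z) , ≁-sym eb , tt)
      , (Ear.ta T , Ear.tc T , ear≁skip W T T′ , Ear.td T , ∼-sym (far∼ear W Z T) , Ear.te T , tt)
      , (ac , ≁-sym (Ear.td T′) , ≁-sym da , ≁-sym (Far.za Z) , ∼-sym ea , tt)
      , (∼-sym (Ear.ta T′) , cd , ≁-sym (Far.zc Z) , ce , tt)
      , (Ear.tb T′ , ∼-sym (far∼ear (r² W) (rotate-far (rotate-far Z)) T′) , Ear.tc T′ , tt)
      , (≁-sym (Far.zd Z) , de , tt)
      , (Far.ze Z , tt) , tt , tt)
      where open Wheel W

    -- The triangles v a e and c t₂ t₃ are joined by the edge vc and the paths a t₁ t₂ and e t₄ t₃.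
    four-ears-prism : ∀ {a b c d e v t₁ t₂ t₃ t₄} → Wheel a b c d e v →
      Ear a b c d e t₁ → Ear b c d e a t₂ → Ear c d e a b t₃ → Ear d e a b c t₄ → ⊥
    four-ears-prism W T₁ T₂ T₃ T₄ = no-prism
      ( (va , ve , vc , hub≁ear (r¹ W) (Wheel.centre (r¹ W)) T₂ , hub≁ear (r² W) (Wheel.centre (r² W)) T₃
          , hub≁ear W centre T₁ , hub≁ear (r³ W) (Wheel.centre (r³ W)) T₄ , tt)
      , (∼-sym ea , ac , ≁-sym (Ear.te T₂) , ≁-sym (Ear.td T₃) , ∼-sym (Ear.ta T₁) , ≁-sym (Ear.tc T₄) , tt)
      , (≁-sym ce , ≁-sym (Ear.td T₂) , ≁-sym (Ear.tc T₃) , ≁-sym (Ear.te T₁) , ∼-sym (Ear.tb T₄) , tt)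
      , (∼-sym (Ear.tb T₂) , ∼-sym (Ear.ta T₃) , ≁-sym (Ear.tc T₁) , ≁-sym (Ear.te T₄) , tt)
      , (ear∼next (r¹ W) T₂ T₃ , ∼-sym (ear∼next W T₁ T₂) , ear≁skip (r¹ W) T₂ T₄ , tt)
      , (≁-sym (ear≁skip W T₁ T₃) , ear∼next (r² W) T₃ T₄ , tt)
      , (≁-sym (ear≁skip (r³ W) T₄ T₁) , tt) , tt , tt)
      where open Wheel W

    far≁rim : ∀ {a b c d e z r} → Far a b c d e z → Rim a b c d e r → ¬ r ∼ z
    far≁rim Z at-a = proj₂ (Far.za Z) ∘ ∼-sym
    far≁rim Z at-b = proj₂ (Far.zb Z) ∘ ∼-sym
    far≁rim Z at-c = proj₂ (Far.zc Z) ∘ ∼-sym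
    far≁rim Z at-d = proj₂ (Far.zd Z) ∘ ∼-sym
    far≁rim Z at-e = proj₂ (Far.ze Z) ∘ ∼-sym

    far-ear-clique : ∀ {a b c d e v z t r} → Wheel a b c d e v → Far a b c d e z → Ear a b c d e t →
                     Kind a b c d e r → r ∼ z → t ≢ r → t ∼ r
    far-ear-clique W Z T (is-rim p) rz t≢r   = ⊥-elim (far≁rim Z p rz)
    far-ear-clique W Z T (is-hub p) rz t≢r   = ⊥-elim (proj₂ (hub≁far W p Z) rz)
    far-ear-clique W Z T (is-ear₁ p) rz t≢r  = ear∼ear W T p t≢r
    far-ear-clique W Z T (is-ear₂ p) rz t≢r  = ear∼next W T p
    far-ear-clique W Z T (is-ear₃ p) rz t≢r  = ⊥-elim (far-prism W Z T p)
    far-ear-clique W Z T (is-ear₄ p) rz t≢r  = ⊥-elim (far-prism (r³ W) (rotate-far (rotate-far (rotate-far Z))) p T)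
    far-ear-clique W Z T (is-ear₅ p) rz t≢r  = ∼-sym (ear∼next (r⁴ W) p T)
    far-ear-clique W Z T (is-far p) rz t≢r   = ∼-sym (far∼ear W p T)

    far-clique : ∀ {a b c d e v z r r′} → Wheel a b c d e v → Far a b c d e z →
                 Kind a b c d e r → Kind a b c d e r′ → r ∼ z → r′ ∼ z → r ≢ r′ → r ∼ r′
    far-clique W Z (is-rim p) k rz = ⊥-elim (far≁rim Z p rz)
    far-clique W Z (is-hub p) k rz = ⊥-elim (proj₂ (hub≁far W p Z) rz)
    far-clique W Z (is-ear₁ p) k rz = far-ear-clique W Z p k
    far-clique W Z (is-ear₂ p) k rz = far-ear-clique (r¹ W) (f¹ Z) p (rotate-kind k)
      where f¹ = rotate-far
    far-clique W Z (is-ear₃ p) k rz =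
      far-ear-clique (r² W) (rotate-far (rotate-far Z)) p (rotate-kind (rotate-kind k))
    far-clique W Z (is-ear₄ p) k rz = far-ear-clique (r³ W) (rotate-far (rotate-far (rotate-far Z))) p
      (rotate-kind (rotate-kind (rotate-kind k)))
    far-clique W Z (is-ear₅ p) k rz = far-ear-clique (r⁴ W) (rotate-far (rotate-far (rotate-far (rotate-far Z)))) p
      (rotate-kind (rotate-kind (rotate-kind (rotate-kind k))))
    far-clique W Z (is-far p) (is-far q) rz r′z r≢r′ = far∼far W p q r≢r′
    far-clique W Z (is-far p) (is-rim q) rz r′z r≢r′ = ⊥-elim (far≁rim Z q r′z)
    far-clique W Z (is-far p) (is-hub q) rz r′z r≢r′ = ⊥-elim (proj₂ (hub≁far W q Z) r′z)
    far-clique W Z (is-far p) (is-ear₁ q) rz r′z r≢r′ = far∼ear W p q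
    far-clique W Z (is-far p) (is-ear₂ q) rz r′z r≢r′ = far∼ear (r¹ W) (rotate-far p) q
    far-clique W Z (is-far p) (is-ear₃ q) rz r′z r≢r′ = far∼ear (r² W) (rotate-far (rotate-far p)) q
    far-clique W Z (is-far p) (is-ear₄ q) rz r′z r≢r′ = far∼ear (r³ W) (rotate-far (rotate-far (rotate-far p))) q
    far-clique W Z (is-far p) (is-ear₅ q) rz r′z r≢r′ =
      far∼ear (r⁴ W) (rotate-far (rotate-far (rotate-far (rotate-far p)))) q

    -- Exchange inequalities of a full-support facet rule out every 5-wheel.

    module FacetDefiningCase
      (ℝ : CompleteOrderedField) {ω : Vector (CompleteOrderedField.Carrier ℝ) n} {β} (facet : Facet ℝ (STAB ℝ G) ω β)
      (ω≉0 : ∀ i → ¬ CompleteOrderedField._≈_ ℝ (ω i) (CompleteOrderedField.0# ℝ)) (other : ∀ (i : Fin n) →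
        ∃ λ (j : Fin n) → j ≢ i)
      where
      open OrderedField ℝ using (Carrier; _≈_; _≤_; _+_; 0#; ≤-trans; ≤-reflexive; +-mono-≤; ≤-refl; +-comm;
        x+y≤x⇒y≤0)
      open Polyhedra ℝ
      open Facets G facet
      open FullFacet ω≉0 other

      -- A tight set missing the closed neighbourhood of `z` could be enlarged by `z`.
      not-simplicial : ∀ {z u} → z ≁ u → (∀ {r r′} → r ∼ z → r′ ∼ z → r ≢ r′ → r ∼ r′) → ⊥
      not-simplicial {z} (z≢u , z≁u) clique = clique-missed (λ i → i Finₚ.≟ z ⊎-dec i ∼? z)
        (λ { (inj₁ refl) (inj₁ refl) i≢j → ⊥-elim (i≢j refl) ; (inj₁ refl) (inj₂ jz) _ → ∼-sym jz
           ; (inj₂ iz) (inj₁ refl) _ → iz ; (inj₂ iz) (inj₂ jz) i≢j → clique iz jz i≢j })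
        (inj₁ refl) z≢u z≁u
        λ tight missed → let (r , r∈S , rz) = tight-maximal tight (λ z∈S → missed z∈S (inj₁ refl)) in missed r∈S (inj₂ rz)

      no-far : ∀ {a b c d e v z} → Wheel a b c d e v → ¬ Far a b c d e z
      no-far W Z = not-simplicial (Far.za Z) λ {r} {r′} →
        far-clique W Z (kind (Wheel.cycle W) r) (kind (Wheel.cycle W) r′)

      NoHub : (a b c d e : Fin n) → Subset n → Set
      NoHub a b c d e S = ∀ {i} → i ∈ S → ¬ Hub a b c d e i

      No : (a b c d e : Fin n) → Set
      No a b c d e = ∀ {t} → ¬ Ear a b c d e t

      -- An eliminator over the possible neighbours of `a`, letting each use refute the cases
      -- excluded there; rotating the wheel gives the other rim vertices.
      rim-neighbour : ∀ {a b c d e v r} → Wheel a b c d e v → {P : Fin n → Set} → r ∼ a →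
        (r ≡ b → P b) → (r ≡ e → P e) → (Hub a b c d e r → P r) → (Ear a b c d e r → P r) → (Ear e a b c d r → P r) →
          P r
      rim-neighbour {a} {r = r} W ra next prev hb ear₁ ear₅ with kind (Wheel.cycle W) r
      ... | is-rim at-a = ⊥-elim (∼-irrefl refl ra)
      ... | is-rim at-b = next refl
      ... | is-rim at-c = ⊥-elim (proj₂ (Wheel.ac W) (∼-sym ra))
      ... | is-rim at-d = ⊥-elim (proj₂ (Wheel.da W) ra)
      ... | is-rim at-e = prev refl
      ... | is-hub h    = hb h
      ... | is-ear₁ t   = ear₁ t
      ... | is-ear₂ t   = ⊥-elim (proj₂ (Ear.te t) ra)
      ... | is-ear₃ t   = ⊥-elim (proj₂ (Ear.td t) ra)
      ... | is-ear₄ t   = ⊥-elim (proj₂ (Ear.tc t) ra)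
      ... | is-ear₅ t   = ear₅ t
      ... | is-far z    = ⊥-elim (proj₂ (Far.za z) ra)

      ear-neighbour : ∀ {a b c d e v t r} → Wheel a b c d e v → Ear a b c d e t → {P : Fin n → Set} → r ∼ t →
        (r ≡ a → P a) → (r ≡ b → P b) → (Ear a b c d e r → P r) → (Ear b c d e a r → P r) → (Ear e a b c d r → P r) →
          P r
      ear-neighbour {r = r} W T rt on-a on-b ear₁ ear₂ ear₅ with kind (Wheel.cycle W) r
      ... | is-rim at-a = on-a refl
      ... | is-rim at-b = on-b refl
      ... | is-rim at-c = ⊥-elim (proj₂ (Ear.tc T) (∼-sym rt))
      ... | is-rim at-d = ⊥-elim (proj₂ (Ear.td T) (∼-sym rt))
      ... | is-rim at-e = ⊥-elim (proj₂ (Ear.te T) (∼-sym rt))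
      ... | is-hub h    = ⊥-elim (proj₂ (hub≁ear W h T) rt)
      ... | is-ear₁ t   = ear₁ t
      ... | is-ear₂ t   = ear₂ t
      ... | is-ear₃ t   = ⊥-elim (proj₂ (ear≁skip W T t) (∼-sym rt))
      ... | is-ear₄ t   = ⊥-elim (proj₂ (ear≁skip (r³ W) t T) rt)
      ... | is-ear₅ t   = ear₅ t
      ... | is-far z    = ⊥-elim (no-far W z)

      NearEar : (a b c d e : Fin n) → Fin n → Set
      NearEar a b c d e r = r ≡ a ⊎ r ≡ b ⊎ Ear a b c d e r

      near-ear-clique : ∀ {a b c d e v r r′} → Wheel a b c d e v → NearEar a b c d e r → NearEar a b c d e r′ →
        r ≢ r′ → r ∼ r′
      near-ear-clique W (inj₁ refl)        (inj₁ refl)        r≢r′ = ⊥-elim (r≢r′ refl)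
      near-ear-clique W (inj₁ refl)        (inj₂ (inj₁ refl)) r≢r′ = Wheel.ab W
      near-ear-clique W (inj₁ refl)        (inj₂ (inj₂ T′))   r≢r′ = ∼-sym (Ear.ta T′)
      near-ear-clique W (inj₂ (inj₁ refl)) (inj₁ refl)        r≢r′ = ∼-sym (Wheel.ab W)
      near-ear-clique W (inj₂ (inj₁ refl)) (inj₂ (inj₁ refl)) r≢r′ = ⊥-elim (r≢r′ refl)
      near-ear-clique W (inj₂ (inj₁ refl)) (inj₂ (inj₂ T′))   r≢r′ = ∼-sym (Ear.tb T′)
      near-ear-clique W (inj₂ (inj₂ T))    (inj₁ refl)        r≢r′ = Ear.ta T
      near-ear-clique W (inj₂ (inj₂ T))    (inj₂ (inj₁ refl)) r≢r′ = Ear.tb T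
      near-ear-clique W (inj₂ (inj₂ T))    (inj₂ (inj₂ T′))   r≢r′ = ear∼ear W T T′ r≢r′

      lone-ear : ∀ {a b c d e v t} → Wheel a b c d e v → Ear a b c d e t → No b c d e a → No e a b c d → ⊥
      lone-ear {a} {b} {c} {d} {e} {t = t} W T no₂ no₅ =
        not-simplicial (Ear.tc T) λ rt r′t → near-ear-clique W (near rt) (near r′t)
        where
        near : ∀ {r} → r ∼ t → NearEar a b c d e r
        near rt = ear-neighbour W T {NearEar a b c d e} rt (λ _ → inj₁ refl) (λ _ → inj₂ (inj₁ refl)) (inj₂ ∘ inj₂)
          (⊥-elim ∘ no₂) (⊥-elim ∘ no₅)

      hub-neighbour : ∀ {a b c d e v w r} → Wheel a b c d e v → Hub a b c d e w → {A : Set} → r ∼ w →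
        (Rim a b c d e r → A) → (Hub a b c d e r → A) → A
      hub-neighbour {w = w} {r} W H rw rm hb with kind (Wheel.cycle W) r
      ... | is-rim p  = rm p
      ... | is-hub h  = hb h
      ... | is-ear₁ t = ⊥-elim (proj₂ (≁-sym (hub≁ear W H t)) rw)
      ... | is-ear₂ t = ⊥-elim (proj₂ (≁-sym (hub≁ear (r¹ W) (rotate-hub H) t)) rw)
      ... | is-ear₃ t = ⊥-elim (proj₂ (≁-sym (hub≁ear (r² W) (h² H) t)) rw)
      ... | is-ear₄ t = ⊥-elim (proj₂ (≁-sym (hub≁ear (r³ W) (h³ H) t)) rw)
      ... | is-ear₅ t = ⊥-elim (proj₂ (≁-sym (hub≁ear (r⁴ W) (rotate-hub (h³ H)) t)) rw)
      ... | is-far z  = ⊥-elim (no-far W z)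

      hub? : ∀ a b c d e → Decidable (Hub a b c d e)
      hub? a b c d e w with w ∼? a | w ∼? b | w ∼? c | w ∼? d | w ∼? e
      ... | yes p | yes q | yes r | yes s | yes t = yes (hub p q r s t)
      ... | no ¬p | _ | _ | _ | _ = no (¬p ∘ Hub.va)
      ... | _ | no ¬p | _ | _ | _ = no (¬p ∘ Hub.vb)
      ... | _ | _ | no ¬p | _ | _ = no (¬p ∘ Hub.vc)
      ... | _ | _ | _ | no ¬p | _ = no (¬p ∘ Hub.vd)
      ... | _ | _ | _ | _ | no ¬p = no (¬p ∘ Hub.ve)

      ear? : ∀ a b c d e → Decidable (Ear a b c d e)
      ear? a b c d e t with t ∼? a | t ∼? b | t ≁? c | t ≁? d | t ≁? e
      ... | yes p | yes q | yes r | yes s | yes u = yes (ear p q r s u)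
      ... | no ¬p | _ | _ | _ | _ = no (¬p ∘ Ear.ta)
      ... | _ | no ¬p | _ | _ | _ = no (¬p ∘ Ear.tb)
      ... | _ | _ | no ¬p | _ | _ = no (¬p ∘ Ear.tc)
      ... | _ | _ | _ | no ¬p | _ = no (¬p ∘ Ear.td)
      ... | _ | _ | _ | _ | no ¬p = no (¬p ∘ Ear.te)

      rim? : ∀ a b c d e → Decidable (Rim a b c d e)
      rim? a b c d e r with r Finₚ.≟ a | r Finₚ.≟ b | r Finₚ.≟ c | r Finₚ.≟ d | r Finₚ.≟ e
      ... | yes refl | _ | _ | _ | _ = yes at-a
      ... | _ | yes refl | _ | _ | _ = yes at-b
      ... | _ | _ | yes refl | _ | _ = yes at-c
      ... | _ | _ | _ | yes refl | _ = yes at-d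
      ... | _ | _ | _ | _ | yes refl = yes at-e
      ... | no ¬a | no ¬b | no ¬c | no ¬d | no ¬e =
        no λ { at-a → ¬a refl ; at-b → ¬b refl ; at-c → ¬c refl ; at-d → ¬d refl ; at-e → ¬e refl }

      -- The ear plays two parts: it makes the hubs together with `x` and `y` a clique, and it is
      -- the non-neighbour of `v` that `clique-missed` asks for.
      hub-edge-missed : ∀ {a b c d e v t} → Wheel a b c d e v → Ear a b c d e t → ∀ {x y} →
        Rim a b c d e x → Rim a b c d e y → x ∼ y →
        (∀ {S} → Tight S → NoHub a b c d e S → x ∉ S → y ∉ S → ⊥) → ⊥
      hub-edge-missed {a} {b} {c} {d} {e} {v} W T {x} {y} px py xy none = clique-missed {K = K}
        (λ i → hub? a b c d e i ⊎-dec (i Finₚ.≟ x ⊎-dec i Finₚ.≟ y)) clique (inj₁ (Wheel.centre W)) (proj₁ v≁t)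
          (proj₂ v≁t)
        λ tight missed → none tight (λ i∈S h → missed i∈S (inj₁ h)) (λ x∈S → missed x∈S (inj₂ (inj₁ refl)))
          (λ y∈S → missed y∈S (inj₂ (inj₂ refl)))
        where
        v≁t = hub≁ear W (Wheel.centre W) T
        K : Fin n → Set
        K i = Hub a b c d e i ⊎ (i ≡ x ⊎ i ≡ y)
        clique : ∀ {i j} → K i → K j → i ≢ j → i ∼ j
        clique (inj₁ h) (inj₁ h′) i≢j = hub∼hub W T h h′ i≢j
        clique (inj₁ h) (inj₂ (inj₁ refl)) i≢j = rim∼hub h px
        clique (inj₁ h) (inj₂ (inj₂ refl)) i≢j = rim∼hub h py
        clique (inj₂ (inj₁ refl)) (inj₁ h) i≢j = ∼-sym (rim∼hub h px)
        clique (inj₂ (inj₂ refl)) (inj₁ h) i≢j = ∼-sym (rim∼hub h py)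
        clique (inj₂ (inj₁ refl)) (inj₂ (inj₁ refl)) i≢j = ⊥-elim (i≢j refl)
        clique (inj₂ (inj₁ refl)) (inj₂ (inj₂ refl)) i≢j = xy
        clique (inj₂ (inj₂ refl)) (inj₂ (inj₁ refl)) i≢j = ∼-sym xy
        clique (inj₂ (inj₂ refl)) (inj₂ (inj₂ refl)) i≢j = ⊥-elim (i≢j refl)

      -- At most one rim vertex comes from `wheel-missed`; at least one comes from maximality at
      -- `v`, whose neighbours are rim vertices and hubs only.
      one-rim : ∀ {a b c d e v t} → Wheel a b c d e v → Ear a b c d e t →
        (∀ {S r} → Tight S → r ∈ S → Rim a b c d e r → NoHub a b c d e S → (∀ {i} → i ∈ S → Rim a b c d e i → i ≡ r)
          → ⊥) → ⊥
      one-rim {a} {b} {c} {d} {e} {v} W T none = wheel-missed (hub? a b c d e) (rim? a b c d e)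
        (hub∼hub W T) rim∼hub
        (λ pi pj pk i≢j i≢k j≢k i≁j i≁k j≁k → claw (rim∼hub centre pi) (rim∼hub centre pj) (rim∼hub centre pk)
          (i≢j , i≁j) (i≢k , i≁k) (j≢k , j≁k))
        centre (proj₁ v≁t) (proj₂ v≁t)
        λ tight no-hub unique → let (r , r∈S , rv) = tight-maximal tight (λ v∈S → no-hub v∈S centre) in
          hub-neighbour W centre rv (λ p → none tight r∈S p no-hub λ i∈S q → unique i∈S r∈S q p) (no-hub r∈S)
        where
        open Wheel W
        v≁t = hub≁ear W centre T

      apart-in : ∀ {S x y} → Tight S → x ∈ S → y ∈ S → ¬ x ∼ y
      apart-in (S-stable , _) = S-stable _ _

      x+y≰x : ∀ {x y z} → ω x + ω y ≤ z → ¬ z ≤ ω x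
      x+y≰x {y = y} p q = a≰0 y (x+y≤x⇒y≤0 (≤-trans p q))

      x+y≰y : ∀ {x y z} → ω x + ω y ≤ z → ¬ z ≤ ω y
      x+y≰y p = x+y≰x (≤-trans (≤-reflexive (+-comm _ _)) p)

      x+y≤z⇒x≤z : ∀ {x y z} → ω x + ω y ≤ z → ω x ≤ z
      x+y≤z⇒x≤z {x} {y} p with OrderedField.total ℝ (ω y) 0#
      ... | inj₁ y≤0 = ⊥-elim (a≰0 y y≤0)
      ... | inj₂ 0≤y = ≤-trans (≤-trans (≤-reflexive (OrderedField.≈-sym ℝ (OrderedField.+-identityʳ ℝ _)))
        (+-mono-≤ ≤-refl 0≤y)) p

      -- Maximality at `a` puts an ear over ab into `S`, which keeps out the ears over bc; so `c`
      -- and `e` can replace `d`, giving c + e ≤ d. A tight set missing the hubs, `c` and `d` must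
      -- contain `e`, and there `d` can replace `e`, giving d ≤ e.
      two-ears-at-d : ∀ {a b c d e v t₁ S} → Wheel a b c d e v → Ear a b c d e t₁ → No c d e a b → No d e a b c →
        No e a b c d → Tight S → d ∈ S → NoHub a b c d e S → (∀ {i} → i ∈ S → Rim a b c d e i → i ≡ d) → ⊥
      two-ears-at-d {a} {b} {c} {d} {e} {S = S} W T₁ no₃ no₄ no₅ tight d∈S no-hub unique =
          hub-edge-missed W T₁ at-c at-d cd contradict
          where
          open Wheel W
          ∉a : a ∉ S
          ∉a a∈S = proj₁ da (≡.sym (unique a∈S at-a))
          ∉b : b ∉ S
          ∉b b∈S = proj₁ bd (unique b∈S at-b)
          ∉c : c ∉ S
          ∉c c∈S = ∼⇒≢ cd (unique c∈S at-c)
          ∉e : e ∉ S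
          ∉e e∈S = ∼⇒≢ de (≡.sym (unique e∈S at-e))
          ear-in : ∃[ t ] t ∈ S × Ear a b c d e t
          ear-in with tight-maximal tight ∉a
          ... | r , r∈S , ra = r , r∈S , rim-neighbour W {Ear a b c d e} ra
                  (λ { refl → ⊥-elim (∉b r∈S) }) (λ { refl → ⊥-elim (∉e r∈S) }) (⊥-elim ∘ no-hub r∈S) (λ t → t)
                    (⊥-elim ∘ no₅)
          c+e≤d : ω c + ω e ≤ ω d
          c+e≤d = exchange₂ tight d∈S ∉c ∉e (proj₁ ce) (proj₂ ce)
            (λ {r} r∈S rc → rim-neighbour (r² W) {_≡ d} rc (λ _ → refl) (λ { refl → ⊥-elim (∉b r∈S) })
              (⊥-elim ∘ no-hub r∈S ∘ h³) (⊥-elim ∘ no₃)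
              (λ T → let (t , t∈S , T′) = ear-in in ⊥-elim (apart-in tight t∈S r∈S (ear∼next W T′ T))))
            (λ {r} r∈S re → rim-neighbour (r⁴ W) {_≡ d} re (λ { refl → ⊥-elim (∉a r∈S) }) (λ _ → refl)
              (⊥-elim ∘ no-hub r∈S ∘ rotate-hub) (⊥-elim ∘ no₅) (⊥-elim ∘ no₄))
          contradict : ∀ {S} → Tight S → NoHub a b c d e S → c ∉ S → d ∉ S → ⊥
          contradict {S} tight no-hub ∉c ∉d with tight-maximal tight ∉d
          ... | r , r∈S , rd = x+y≰y c+e≤d (exchange₁ tight (≡.subst (_∈ S) (is-e r∈S rd) r∈S) ∉d is-e)
            where
            is-e : ∀ {r} → r ∈ S → r ∼ d → r ≡ e
            is-e r∈S rd = rim-neighbour (r³ W) {_≡ e} rd (λ _ → refl) (λ { refl → ⊥-elim (∉c r∈S) })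
              (⊥-elim ∘ no-hub r∈S ∘ h²) (⊥-elim ∘ no₄) (⊥-elim ∘ no₃)

      two-ears : ∀ {a b c d e v t₁ t₂} → Wheel a b c d e v → Ear a b c d e t₁ → Ear b c d e a t₂ →
                 No c d e a b → No d e a b c → No e a b c d → ⊥
      two-ears {a} {b} {c} {d} {e} W T₁ T₂ no₃ no₄ no₅ = one-rim W T₁ λ where
          tight r∈S at-a no-hub unique → d-free tight no-hub (λ p → proj₁ ac (≡.sym (unique p at-c)))
            (λ p → proj₁ da (unique p at-d)) (λ p → ∼⇒≢ ea (unique p at-e))
          tight r∈S at-b no-hub unique → d-free tight no-hub (λ p → ∼⇒≢ bc (≡.sym (unique p at-c)))
            (λ p → proj₁ bd (≡.sym (unique p at-d))) (λ p → proj₁ eb (unique p at-e))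
          tight r∈S at-c no-hub unique → e-free tight no-hub (λ p → ∼⇒≢ cd (≡.sym (unique p at-d)))
            (λ p → proj₁ ce (≡.sym (unique p at-e))) (λ p → proj₁ ac (unique p at-a))
          tight r∈S at-d no-hub unique → two-ears-at-d W T₁ no₃ no₄ no₅ tight r∈S no-hub unique
          -- The reflection fixing `b` swaps the two kinds of ears and exchanges `d` with `e`.
          tight r∈S at-e no-hub unique → two-ears-at-d (reflect W) (reflect-ear T₂) (no₅ ∘ reflect-ear)
            (no₄ ∘ reflect-ear) (no₃ ∘ reflect-ear) tight r∈S (λ p → no-hub p ∘ reflect-hub) (λ p → unique p ∘ reflect-rim)
        where
        open Wheel W
        d-free : ∀ {S} → Tight S → NoHub a b c d e S → c ∉ S → d ∉ S → e ∉ S → ⊥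
        d-free tight no-hub ∉c ∉d ∉e with tight-maximal tight ∉d
        ... | r , r∈S , rd = rim-neighbour (r³ W) {λ _ → ⊥} rd (λ { refl → ∉e r∈S }) (λ { refl → ∉c r∈S })
          (no-hub r∈S ∘ h²) no₄ no₃
        e-free : ∀ {S} → Tight S → NoHub a b c d e S → d ∉ S → e ∉ S → a ∉ S → ⊥
        e-free tight no-hub ∉d ∉e ∉a with tight-maximal tight ∉e
        ... | r , r∈S , re = rim-neighbour (r⁴ W) {λ _ → ⊥} re (λ { refl → ∉a r∈S }) (λ { refl → ∉d r∈S })
          (no-hub r∈S ∘ rotate-hub) no₅ no₄

      -- Reflection in the axis through e.
      reflectₑ : ∀ {a b c d e v} → Wheel a b c d e v → Wheel d c b a e v
      reflectₑ = r⁴ ∘ reflect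

      -- In a tight set missing the hubs, `d` and `e`, maximality at `e` forces `a`, and maximality
      -- at `d` forces `c` or an ear over cd. The latter excludes ears over bc, so `a` is the only
      -- neighbour of `t₁` and `e` and can be exchanged for both.
      ear-below-a : ∀ {a b c d e v t₁} → Wheel a b c d e v → Ear a b c d e t₁ → No d e a b c → No e a b c d →
                    (ω t₁ + ω e ≤ ω a → ⊥) → ⊥
      ear-below-a {a} {b} {c} {d} {e} {v} {t₁} W T₁ no₄ no₅ k =
        hub-edge-missed W T₁ at-d at-e de λ {S} tight no-hub ∉d ∉e →
        let is-a : ∀ {r} → r ∈ S → r ∼ e → r ≡ a
            is-a r∈S re = rim-neighbour (r⁴ W) {_≡ a} re (λ _ → refl) (λ { refl → ⊥-elim (∉d r∈S) })
              (⊥-elim ∘ no-hub r∈S ∘ rotate-hub) (⊥-elim ∘ no₅) (⊥-elim ∘ no₄)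
            (r , r∈S , re) = tight-maximal tight ∉e
            a∈S = ≡.subst (_∈ S) (is-a r∈S re) r∈S
        in k (exchange₂ tight a∈S (λ t₁∈S → apart-in tight t₁∈S a∈S (Ear.ta T₁)) ∉e (proj₁ (Ear.te T₁))
          (proj₂ (Ear.te T₁))
          (λ r∈S rt → ear-neighbour W T₁ {_≡ a} rt (λ _ → refl) (λ { refl → ⊥-elim (apart-in tight a∈S r∈S ab) })
            (λ T → ⊥-elim (apart-in tight r∈S a∈S (Ear.ta T))) (⊥-elim ∘ no-ear₂ tight no-hub ∉d ∉e r∈S)
              (⊥-elim ∘ no₅))
          is-a)
        where
        open Wheel W
        no-ear₂ : ∀ {S t} → Tight S → NoHub a b c d e S → d ∉ S → e ∉ S → t ∈ S → ¬ Ear b c d e a t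
        no-ear₂ tight no-hub ∉d ∉e t∈S T with tight-maximal tight ∉d
        ... | r , r∈S , rd = rim-neighbour (r³ W) {λ _ → ⊥} rd (λ { refl → ∉e r∈S })
          (λ { refl → apart-in tight t∈S r∈S (Ear.tb T) })
              (no-hub r∈S ∘ h²) no₄ (λ T′ → apart-in tight t∈S r∈S (ear∼next (r¹ W) T T′))

      -- Witnessed by a tight stable set missing the clique {a , b} ∪ {ears over ab}.
      exceeding-a+d : ∀ {a b c d e v t₁} → Wheel a b c d e v → Ear a b c d e t₁ → No d e a b c → No e a b c d →
                      (∀ {s} → s ≡ e ⊎ Hub a b c d e s → ω a + ω d ≤ ω s → ⊥) → ⊥
      exceeding-a+d {a} {b} {c} {d} {e} {v} {t₁} W T₁ no₄ no₅ k =
        clique-missed {K = NearEar a b c d e} (λ i → i Finₚ.≟ a ⊎-dec i Finₚ.≟ b ⊎-dec ear? a b c d e i)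
          (near-ear-clique W) (inj₁ refl) (proj₁ ac) (proj₂ ac) missing
        where
        open Wheel W
        Top : Fin n → Set
        Top s = s ≡ e ⊎ Hub a b c d e s
        top-clique : ∀ {i j} → Top i → Top j → i ≢ j → i ∼ j
        top-clique (inj₁ refl) (inj₁ refl) i≢j = ⊥-elim (i≢j refl)
        top-clique (inj₁ refl) (inj₂ h)    i≢j = ∼-sym (Hub.ve h)
        top-clique (inj₂ h)    (inj₁ refl) i≢j = Hub.ve h
        top-clique (inj₂ h)    (inj₂ h′)   i≢j = hub∼hub W T₁ h h′ i≢j
        top∼d : ∀ {i} → Top i → i ∼ d
        top∼d (inj₁ refl) = ∼-sym de
        top∼d (inj₂ h)    = Hub.vd h
        missing : ∀ {S} → Tight S → (∀ {i} → i ∈ S → ¬ NearEar a b c d e i) → ⊥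
        missing {S} tight missed with tight-maximal tight
          (λ t₁∈S → missed t₁∈S (inj₂ (inj₂ T₁))) | tight-maximal tight (λ a∈S → missed a∈S (inj₁ refl))
        -- Maximality at `t₁` yields an ear `t₂` over bc, and at `a` a vertex `s` that is `e` or a
        -- hub. As `t₂` excludes `c` and the ears over cd, `s` is the only neighbour in `S` of both
        -- `a` and `d`.
        ... | t₂ , t₂∈S , t₂∼t₁ | s , s∈S , sa = k top-s
              (exchange₂ tight s∈S (λ a∈S → missed a∈S (inj₁ refl)) (λ d∈S → apart-in tight s∈S d∈S (top∼d top-s))
                (proj₁ (≁-sym da)) (proj₂ (≁-sym da))
                (λ r∈S ra → unique r∈S (top r∈S ra))
                (λ {r} r∈S rd → rim-neighbour (r³ W) {_≡ s} rd (λ { refl → unique r∈S (inj₁ refl) })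
                  (λ { refl → ⊥-elim (apart-in tight t₂∈S r∈S (Ear.tb T₂)) }) (λ h → unique r∈S (inj₂ (h² h)))
                  (⊥-elim ∘ no₄) (λ T₃ → ⊥-elim (apart-in tight t₂∈S r∈S (ear∼next (r¹ W) T₂ T₃)))))
          where
          T₂ : Ear b c d e a t₂
          T₂ = ear-neighbour W T₁ {Ear b c d e a} t₂∼t₁ (λ p → ⊥-elim (missed t₂∈S (inj₁ p)))
            (λ p → ⊥-elim (missed t₂∈S (inj₂ (inj₁ p))))
            (λ T → ⊥-elim (missed t₂∈S (inj₂ (inj₂ T)))) (λ T → T) (⊥-elim ∘ no₅)
          top : ∀ {r} → r ∈ S → r ∼ a → Top r
          top {r} r∈S ra = rim-neighbour W {λ _ → Top r} ra (λ p → ⊥-elim (missed r∈S (inj₂ (inj₁ p)))) inj₁ inj₂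
            (λ T → ⊥-elim (missed r∈S (inj₂ (inj₂ T)))) (⊥-elim ∘ no₅)
          top-s : Top s
          top-s = top s∈S sa
          unique : ∀ {r} → r ∈ S → Top r → r ≡ s
          unique {r} r∈S p with r Finₚ.≟ s
          ... | yes r≡s = r≡s
          ... | no r≢s  = ⊥-elim (apart-in tight r∈S s∈S (top-clique p top-s r≢s))

      -- Only an ear `t₃` over cd can dominate `d`, and exchanging it for `t₂` and `d` gives t₂ + d
      -- ≤ t₃. The mirror image of `ear-below-a` gives t₃ + e ≤ d.
      three-ears-at-a : ∀ {a b c d e v t₂ S} → Wheel a b c d e v → Ear b c d e a t₂ → No d e a b c → No e a b c d →
        Tight S → a ∈ S → NoHub a b c d e S → (∀ {i} → i ∈ S → Rim a b c d e i → i ≡ a) → ⊥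
      three-ears-at-a {a} {b} {c} {d} {e} {t₂ =
        t₂} {S} W T₂ no₄ no₅ tight a∈S no-hub unique with tight-maximal tight ∉d
        where
        ∉d : d ∉ S
        ∉d d∈S = proj₁ (Wheel.da W) (unique d∈S at-d)
      ... | t₃ , t₃∈S , t₃d = ear-below-a (reflectₑ W) (reflect-ear T₃) (no₅ ∘ reflect-ear)
        (no₄ ∘ reflect-ear) λ t₃+e≤d →
              x+y≰y t₂+d≤t₃ (x+y≤z⇒x≤z t₃+e≤d)
        where
        open Wheel W
        ∉b : b ∉ S
        ∉b b∈S = ∼⇒≢ ab (≡.sym (unique b∈S at-b))
        ∉c : c ∉ S
        ∉c c∈S = proj₁ ac (≡.sym (unique c∈S at-c))
        ∉e : e ∉ S
        ∉e e∈S = ∼⇒≢ ea (unique e∈S at-e)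
        T₃-of : ∀ {r} → r ∈ S → r ∼ d → Ear c d e a b r
        T₃-of {r} r∈S rd = rim-neighbour (r³ W) {Ear c d e a b} rd (λ { refl → ⊥-elim (∉e r∈S) })
          (λ { refl → ⊥-elim (∉c r∈S) })
          (⊥-elim ∘ no-hub r∈S ∘ h²) (⊥-elim ∘ no₄) (λ T → T)
        T₃ : Ear c d e a b t₃
        T₃ = T₃-of t₃∈S t₃d
        same : ∀ {r} → r ∈ S → Ear c d e a b r → r ≡ t₃
        same {r} r∈S T with r Finₚ.≟ t₃
        ... | yes r≡t₃ = r≡t₃
        ... | no r≢t₃  = ⊥-elim (apart-in tight r∈S t₃∈S (ear∼ear (r² W) T T₃ r≢t₃))
        t₂+d≤t₃ : ω t₂ + ω d ≤ ω t₃
        t₂+d≤t₃ = exchange₂ tight t₃∈S (λ t₂∈S → apart-in tight t₂∈S t₃∈S (ear∼next (r¹ W) T₂ T₃))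
          (λ d∈S → proj₁ da (unique d∈S at-d)) (proj₁ (Ear.tc T₂)) (proj₂ (Ear.tc T₂))
          (λ r∈S rt → ear-neighbour (r¹ W) T₂ {_≡ t₃} rt (λ { refl → ⊥-elim (∉b r∈S) }) (λ { refl → ⊥-elim (∉c r∈S) })
            (λ T → ⊥-elim (apart-in tight r∈S t₃∈S (ear∼next (r¹ W) T T₃))) (same r∈S)
            (λ T → ⊥-elim (apart-in tight r∈S a∈S (Ear.ta T))))
          (λ r∈S rd → same r∈S (T₃-of r∈S rd))

      three-ears : ∀ {a b c d e v t₁ t₂ t₃} → Wheel a b c d e v → Ear a b c d e t₁ → Ear b c d e a t₂ →
        Ear c d e a b t₃ →
                   No d e a b c → No e a b c d → ⊥
      three-ears {a} {b} {c} {d} {e} W T₁ T₂ T₃ no₄ no₅ = ear-below-a W T₁ no₄ no₅ λ t₁+e≤a → exceeding-a+d W T₁ no₄ no₅ λ where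
          (inj₁ refl) a+d≤e → x+y≰y t₁+e≤a (x+y≤z⇒x≤z a+d≤e)
          {w} (inj₂ H) a+d≤w → one-rim W T₁ λ where
            tight r∈S at-a no-hub unique → three-ears-at-a W T₂ no₄ no₅ tight r∈S no-hub unique
            tight r∈S at-b no-hub unique → e-free tight no-hub (λ p → proj₁ bd (≡.sym (unique p at-d)))
              (λ p → proj₁ eb (unique p at-e)) (λ p → ∼⇒≢ ab (unique p at-a))
            tight r∈S at-c no-hub unique → e-free tight no-hub (λ p → ∼⇒≢ cd (≡.sym (unique p at-d)))
              (λ p → proj₁ ce (≡.sym (unique p at-e))) (λ p → proj₁ ac (unique p at-a))
            tight r∈S at-d no-hub unique → three-ears-at-a (reflectₑ W) (reflect-ear T₂) (no₅ ∘ reflect-ear)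
              (no₄ ∘ reflect-ear)
                                             tight r∈S (λ p → no-hub p ∘ h⁻ₑ) (λ p → unique p ∘ rim⁻ₑ)
            -- In `S` only `e` is adjacent to `w`, so a ≤ w ≤ e, against t₁ + e ≤ a.
            tight r∈S at-e no-hub unique → x+y≰y t₁+e≤a (≤-trans (x+y≤z⇒x≤z a+d≤w)
              (exchange₁ tight r∈S (λ w∈S → no-hub w∈S H) λ i∈S iw →
                hub-neighbour W H iw (unique i∈S) (⊥-elim ∘ no-hub i∈S)))
        where
        open Wheel W
        h⁻ₑ : ∀ {i} → Hub d c b a e i → Hub a b c d e i
        h⁻ₑ (hub p q r s t) = hub s r q p t
        rim⁻ₑ : ∀ {i} → Rim d c b a e i → Rim a b c d e i
        rim⁻ₑ at-a = at-d
        rim⁻ₑ at-b = at-c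
        rim⁻ₑ at-c = at-b
        rim⁻ₑ at-d = at-a
        rim⁻ₑ at-e = at-e
        e-free : ∀ {S} → Tight S → NoHub a b c d e S → d ∉ S → e ∉ S → a ∉ S → ⊥
        e-free tight no-hub ∉d ∉e ∉a with tight-maximal tight ∉e
        ... | r , r∈S , re = rim-neighbour (r⁴ W) {λ _ → ⊥} re (λ { refl → ∉a r∈S }) (λ { refl → ∉d r∈S })
          (no-hub r∈S ∘ rotate-hub) no₅ no₄

      -- Every vertex is a rim vertex or a hub, and hubs see the whole rim. A stable triple
      -- therefore lies within the rim, a claw at `v`, or within the hubs, a claw at `a`.
      no-ears : ∀ {a b c d e v} → Wheel a b c d e v → No a b c d e → No b c d e a → No c d e a b → No d e a b c →
        No e a b c d → ⊥
      no-ears {a} {b} {c} {d} {e} W no₁ no₂ no₃ no₄ no₅ with stable-triple α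
      ... | x , y , z , xy , xz , yz = clash (inner x) (inner y) (inner z)
        where
        open Wheel W
        Inner : Fin n → Set
        Inner u = Rim a b c d e u ⊎ Hub a b c d e u
        inner : ∀ u → Inner u
        inner u with kind cycle u
        ... | is-rim p  = inj₁ p
        ... | is-hub h  = inj₂ h
        ... | is-ear₁ t = ⊥-elim (no₁ t)
        ... | is-ear₂ t = ⊥-elim (no₂ t)
        ... | is-ear₃ t = ⊥-elim (no₃ t)
        ... | is-ear₄ t = ⊥-elim (no₄ t)
        ... | is-ear₅ t = ⊥-elim (no₅ t)
        ... | is-far t  = ⊥-elim (no-far W t)
        clash : Inner x → Inner y → Inner z → ⊥
        clash (inj₁ p) (inj₁ q) (inj₁ r) = claw (rim∼hub centre p) (rim∼hub centre q) (rim∼hub centre r) xy xz yz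
        clash (inj₂ p) (inj₂ q) (inj₂ r) = claw (∼-sym (Hub.va p)) (∼-sym (Hub.va q)) (∼-sym (Hub.va r)) xy xz yz
        clash (inj₁ p) (inj₂ q) _        = proj₂ xy (∼-sym (rim∼hub q p))
        clash (inj₂ p) (inj₁ q) _        = proj₂ xy (rim∼hub p q)
        clash (inj₁ p) (inj₁ _) (inj₂ r) = proj₂ xz (∼-sym (rim∼hub r p))
        clash (inj₂ p) (inj₂ _) (inj₁ r) = proj₂ xz (rim∼hub p r)

      ears : ∀ a b c d e → (∃ λ t → Ear a b c d e t) ⊎ No a b c d e
      ears a b c d e with Finₚ.any? (ear? a b c d e)
      ... | yes p = inj₁ p
      ... | no ¬p = inj₂ λ T → ¬p (_ , T)

      consecutive-ears : ∀ {a b c d e v t₁ t₂} → Wheel a b c d e v → Ear a b c d e t₁ → Ear b c d e a t₂ → ⊥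
      consecutive-ears {a} {b} {c} {d} {e} W T₁ T₂ with ears c d e a b | ears d e a b c | ears e a b c d
      ... | inj₁ (_ , T₃) | inj₁ (_ , T₄) | _             = four-ears-prism W T₁ T₂ T₃ T₄
      ... | inj₁ (_ , T₃) | inj₂ no₄      | inj₁ (_ , T₅) = four-ears-prism (r⁴ W) T₅ T₁ T₂ T₃
      ... | inj₁ (_ , T₃) | inj₂ no₄      | inj₂ no₅      = three-ears W T₁ T₂ T₃ no₄ no₅
      ... | inj₂ no₃      | inj₁ (_ , T₄) | inj₁ (_ , T₅) = four-ears-prism (r³ W) T₄ T₅ T₁ T₂
      ... | inj₂ no₃      | inj₁ (_ , T₄) | inj₂ no₅      = lone-ear (r³ W) T₄ no₅ no₃
      ... | inj₂ no₃      | inj₂ no₄      | inj₁ (_ , T₅) = three-ears (r⁴ W) T₅ T₁ T₂ no₃ no₄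
      ... | inj₂ no₃      | inj₂ no₄      | inj₂ no₅      = two-ears W T₁ T₂ no₃ no₄ no₅

      some-ear : ∀ {a b c d e v t₁} → Wheel a b c d e v → Ear a b c d e t₁ → ⊥
      some-ear {a} {b} {c} {d} {e} W T₁ with ears b c d e a | ears e a b c d
      ... | inj₁ (_ , T₂) | _             = consecutive-ears W T₁ T₂
      ... | inj₂ _        | inj₁ (_ , T₅) = consecutive-ears (r⁴ W) T₅ T₁
      ... | inj₂ no₂      | inj₂ no₅      = lone-ear W T₁ no₂ no₅

      no-wheel : ∀ {a b c d e v} → Wheel a b c d e v → ⊥
      no-wheel W = no-ears W (some-ear W) (some-ear (r¹ W)) (some-ear (r² W)) (some-ear (r³ W)) (some-ear (r⁴ W))

theorem9 : (ℝ : CompleteOrderedField) (n : ℕ) (G : Graph n) →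
    ClawFree G → ¬ QuasiLine G → StabilityNumber G 3 →
    FacetDefining ℝ G → LS₊-Imperfect ℝ G
theorem9 ℝ n G claw-free ¬quasi-line α (ω , β , facet , ω≉0) perfect =
  ¬quasi-line (Fouquet.neighbourhood-two-cliques (λ P H → no-wheel (wheel P H)) not-simplicial α)
  where
  open Certificates
  open LovászSchrijver ℝ using (certificate⇒imperfect)
  open NonAdjacency G
  open ClawFreeness claw-free
  open Wheels G claw-free α

  no-LT : ∀ {a b c d e t} → Pentagon a b c d e → t ∼ e → t ∼ a → t ∼ b → t ≁ c → t ≁ d → ⊥
  no-LT {a} {b} {c} {d} {e} {t} (pentagon ab bc cd de ea ac bd ce da eb) te ta tb tc td =
    certificate⇒imperfect (induced LT (a ∷ b ∷ c ∷ d ∷ e ∷ t ∷ [])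
      ( (ab , ac , ≁-sym da , ∼-sym ea , ∼-sym ta , tt) , (bc , bd , ≁-sym eb , ∼-sym tb , tt)
      , (cd , ce , ≁-sym tc , tt) , (de , ≁-sym td , tt) , (∼-sym te , tt) , tt , tt)) LT-certificate perfect

  no-EMN : ∀ {a b c d e t} → Pentagon a b c d e → t ∼ a → t ∼ b → t ∼ c → t ∼ d → t ≁ e → ⊥
  no-EMN {a} {b} {c} {d} {e} {t} (pentagon ab bc cd de ea ac bd ce da eb) ta tb tc td te =
    certificate⇒imperfect (induced EMN (a ∷ b ∷ c ∷ d ∷ e ∷ t ∷ [])
      ( (ab , ac , ≁-sym da , ∼-sym ea , ∼-sym ta , tt) , (bc , bd , ≁-sym eb , ∼-sym tb , tt)
      , (cd , ce , ∼-sym tc , tt) , (de , ∼-sym td , tt) , (≁-sym te , tt) , tt , tt)) EMN-certificate perfect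

  -- Positivity of the coefficients depends on a second vertex: on a single vertex, -x ≤ 0 defines a
  -- facet with full support.
  other : ∀ i → ∃[ j ] j ≢ i
  other i with stable-triple α
  ... | x , y , _ , (x≢y , _) , _ with x Finₚ.≟ i
  ... | yes refl = y , λ y≡x → x≢y (≡.sym y≡x)
  ... | no x≢i   = x , x≢i

  open Attachments no-LT no-EMN (λ ps → certificate⇒imperfect (induced Prism _ ps) Prism-certificate perfect)
  open FacetDefiningCase ℝ facet ω≉0 other
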